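{- For $n\ge 0$ let $B_n(t,q,Y_0,Y_1,Z)$ be defined by the identity of formal power series $$\sum_{n\ge0}(1+t)B_n(t,q,Y_0,Y_1,Z)\frac{u^n}{(t^2;q^2)_{n+1}}=\sum_{s\ge0}t^s\Bigl(1-u\sum_{i=0}^s q^iZ^{\chi(i\ \mathrm{odd})}\Bigr)^{ -1}\frac{(u;q^2)_{\lfloor s/2\rfloor+1}}{(uY_0;q^2)_{\lfloor s/2\rfloor+1}}\,\frac{(-uqY_1Z;q^2)_{\lfloor (s+1)/2\rfloor}}{(-uqZ;q^2)_{\lfloor (s+1)/2\rfloor}}.$$ Then for every $n\ge 0$, $$B_n(t,q,Y_0,Y_1,Z)=\sum_{w\in B_n}t^{\mathrm{fdes}\,w}\,q^{\mathrm{fmaj}\,w}\,Y_0^{\mathrm{fix}^+w}\,Y_1^{\mathrm{fix}^-w}\,Z^{\mathrm{neg}\,w}.$$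
   Context: $(a;q)_0=1$ and $(a;q)_n=(1-a)(1-aq)\cdots(1-aq^{n-1})$ for $n\ge1$. For a statement $A$, $\chi(A)=1$ if $A$ is true and $0$ otherwise. $B_n$ is the set of signed permutations of order $n$: words $w=x_1\cdots x_n$ with $x_i\in\{ -n,\dots,-1,1,\dots,n\}$ and $|x_1|\cdots|x_n|$ a permutation of $12\cdots n$. $\mathrm{neg}\,w$ is the number of negative letters; $\mathrm{fix}^+w=\#\{i>0: x_i=i\}$ and $\mathrm{fix}^-w=\#\{i>0: x_i=-i\}$. $\mathrm{des}\,w=\sum_{i=1}^{n-1}\chi(x_i>x_{i+1})$, $\mathrm{maj}\,w=\sum_{i=1}^{n-1}i\,\chi(x_i>x_{i+1})$ (usual order on integers), $\mathrm{fdes}\,w=2\,\mathrm{des}\,w+\chi(x_1<0)$ and $\mathrm{fmaj}\,w=2\,\mathrm{maj}\,w+\mathrm{neg}\,w$. -}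

module Defs where

open import Algebra.Bundles using (CommutativeRing)
open import Data.Nat as ℕ using (ℕ; zero; suc; _∸_)
open import Data.Bool using (Bool; true; false; if_then_else_; not)
open import Data.List using (List; []; _∷_; _++_; map; filter; length; concatMap; upTo; foldr)
open import Data.Integer as ℤ using (ℤ; +_; ∣_∣)
open import Relation.Nullary.Decidable using (does)
open import Data.Nat.ListAction using (sum)
import Data.List.Relation.Unary.Unique.DecPropositional as UniqueDec

letters : ℕ → List ℤ
letters n = map (λ k → + suc k) (upTo n) ++ map (λ k → ℤ.- (+ suc k)) (upTo n)

words : ℕ → ℕ → List (List ℤ)
words n zero = [] ∷ []
words n (suc k) = concatMap (λ x → map (x ∷_) (words n k)) (letters n)

-- B_n : words of length n over {-n..-1,1..n} whose absolute values
-- |x₁|⋯|xₙ| are pairwise distinct, i.e. form a permutation of 1⋯n.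
SignedPerms : ℕ → List (List ℤ)
SignedPerms n = filter (λ w → UniqueDec.unique? ℕ._≟_ (map ∣_∣ w)) (words n n)

isNeg : ℤ → Bool
isNeg x = does (x ℤ.<? + 0)

χ : Bool → ℕ
χ b = if b then 1 else 0

neg : List ℤ → ℕ
neg [] = 0
neg (x ∷ w) = χ (isNeg x) ℕ.+ neg w

fixFrom : (ℤ → ℤ) → ℕ → List ℤ → ℕ
fixFrom f i [] = 0
fixFrom f i (x ∷ w) = χ (does (x ℤ.≟ f (+ i))) ℕ.+ fixFrom f (suc i) w

fixPlus : List ℤ → ℕ
fixPlus = fixFrom (λ z → z) 1

fixMinus : List ℤ → ℕ
fixMinus = fixFrom ℤ.-_ 1

desPositions : ℕ → List ℤ → List ℕ
desPositions i [] = []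
desPositions i (x ∷ []) = []
desPositions i (x ∷ y ∷ w) =
  if does (y ℤ.<? x) then i ∷ desPositions (suc i) (y ∷ w) else desPositions (suc i) (y ∷ w)

des : List ℤ → ℕ
des w = length (desPositions 1 w)

maj : List ℤ → ℕ
maj w = sum (desPositions 1 w)

firstNeg : List ℤ → ℕ
firstNeg [] = 0
firstNeg (x ∷ w) = χ (isNeg x)

fdes : List ℤ → ℕ
fdes w = 2 ℕ.* des w ℕ.+ firstNeg w

fmaj : List ℤ → ℕ
fmaj w = 2 ℕ.* maj w ℕ.+ neg w

isOdd : ℕ → Bool
isOdd zero = false
isOdd (suc n) = not (isOdd n)

module Series {c ℓ} (R : CommutativeRing c ℓ) where
  open CommutativeRing R

  pow : Carrier → ℕ → Carrier
  pow x zero = 1#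
  pow x (suc n) = x * pow x n

  Σ≤ : ℕ → (ℕ → Carrier) → Carrier
  Σ≤ zero f = f 0
  Σ≤ (suc n) f = Σ≤ n f + f (suc n)

  listSum : List Carrier → Carrier
  listSum = foldr _+_ 0#

  -- a series: F i j is the coefficient of u^i t^j
  Ser : Set c
  Ser = ℕ → ℕ → Carrier

  _≋_ : Ser → Ser → Set ℓ
  F ≋ G = ∀ i j → F i j ≈ G i j

  const : Carrier → Ser
  const a zero zero = a
  const a zero (suc j) = 0#
  const a (suc i) j = 0#

  one : Ser
  one = const 1#

  uVar : Ser
  uVar (suc zero) zero = 1#
  uVar _ _ = 0#

  tVar : Ser
  tVar zero (suc zero) = 1#
  tVar _ _ = 0#

  liftT : (ℕ → Carrier) → Ser
  liftT b zero j = b j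
  liftT b (suc i) j = 0#

  _⊕_ : Ser → Ser → Ser
  (F ⊕ G) i j = F i j + G i j

  _⊖_ : Ser → Ser → Ser
  (F ⊖ G) i j = F i j - G i j

  scale : Carrier → Ser → Ser
  scale a F i j = a * F i j

  _⊗_ : Ser → Ser → Ser
  (F ⊗ G) i j = Σ≤ i (λ a → Σ≤ j (λ b → F a b * G (i ∸ a) (j ∸ b)))

  infixl 7 _⊗_
  infixl 6 _⊕_ _⊖_

  powS : Ser → ℕ → Ser
  powS F zero = one
  powS F (suc k) = F ⊗ powS F k

  -- multiplicative inverse of a series F with constant term 1:
  -- F⁻¹ = Σ_k (1 - F)^k ; only k ≤ i + j contribute to the coefficient of u^i t^j
  inv : Ser → Ser
  inv F i j = Σ≤ (i ℕ.+ j) (λ k → powS (one ⊖ F) k i j)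

  poch : Ser → Carrier → ℕ → Ser
  poch a b zero = one
  poch a b (suc n) = poch a b n ⊗ (one ⊖ scale (pow b n) a)

  -- Σ_{n ≥ 0} u^n G_n  (coefficient of u^i t^j is Σ_{n ≤ i} [u^{i-n} t^j] G_n)
  sumU : (ℕ → Ser) → Ser
  sumU G i j = Σ≤ i (λ n → G n (i ∸ n) j)

  -- Σ_{s ≥ 0} t^s G_s  (coefficient of u^i t^j is Σ_{s ≤ j} [u^i t^{j-s}] G_s)
  sumT : (ℕ → Ser) → Ser
  sumT G i j = Σ≤ j (λ s → G s i (j ∸ s))

  Zodd : Carrier → ℕ → Carrier
  Zodd Z i = if isOdd i then Z else 1#

  cs : Carrier → Carrier → ℕ → Carrier
  cs q Z s = Σ≤ s (λ i → pow q i * Zodd Z i)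

  -- left-hand side: Σ_n (1+t) B_n u^n / (t²;q²)_{n+1}, for a family B
  -- of power series in t (B n j = coefficient of t^j in B_n)
  LHS : Carrier → (ℕ → ℕ → Carrier) → Ser
  LHS q B = sumU (λ n → (one ⊕ tVar) ⊗ liftT (B n) ⊗ inv (poch (tVar ⊗ tVar) (q * q) (suc n)))

  RHS : Carrier → Carrier → Carrier → Carrier → Ser
  RHS q Y₀ Y₁ Z = sumT term
    where
    q² = q * q
    term : ℕ → Ser
    term s =
      inv (one ⊖ scale (cs q Z s) uVar)
      ⊗ poch uVar q² (suc (s ℕ./ 2))
      ⊗ inv (poch (scale Y₀ uVar) q² (suc (s ℕ./ 2)))
      ⊗ poch (scale (- (q * Y₁ * Z)) uVar) q² (suc s ℕ./ 2)
      ⊗ inv (poch (scale (- (q * Z)) uVar) q² (suc s ℕ./ 2))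

  -- combinatorial side: coefficient of t^j in
  -- Σ_{w ∈ B_n} t^{fdes w} q^{fmaj w} Y₀^{fix⁺ w} Y₁^{fix⁻ w} Z^{neg w}
  Bcomb : Carrier → Carrier → Carrier → Carrier → ℕ → ℕ → Carrier
  Bcomb q Y₀ Y₁ Z n j =
    listSum (map (λ w → if does (fdes w ℕ.≟ j)
                        then pow q (fmaj w) * pow Y₀ (fixPlus w) * pow Y₁ (fixMinus w) * pow Z (neg w)
                        else 0#)
                 (SignedPerms n))

{-# OPTIONS --safe #-}

-- Fix s and let a word c₁⋯cₙ over {0,…,s} have weight ∏ q^{cᵢ} Z^{χ(cᵢ odd)}. Sorting the
-- letters decreasingly, with equal even letters read from left to right, equal odd letters
-- from right to left, and the positions of odd letters signed negatively, turns words into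
-- pairs (w , b) where w ∈ Bₙ and b is a decreasing word with parities and strict descents
-- prescribed by w (MacMahon's Verfahren). For fixed w the words b sum up to
-- q^{fmaj w} Z^{neg w} times the coefficient of t^s in t^{fdes w} (1+t)/(t²;q²)_{n+1}, which
-- gives the left-hand side.
--
-- The fixed points of w are the letters of c that sorting leaves in place. For an even value v
-- every word has exactly one place where a fixed v can be put in front of the fixed v's already
-- there; for an odd value v this works precisely for the words without a fixed v, and yields a
-- word with a single one. Inserting v does not change which other letters are fixed. So giving
-- the fixed letters v the weight Y₀ or Y₁ multiplies the generating function of all words by
-- (1 - u q^v)/(1 - u q^v Y₀) for v even and by (1 + u q^v Z Y₁)/(1 + u q^v Z) for v odd. Doing this
-- for v = 0,…,s one after the other, starting from (1 - u Σ q^i Z^{χ(i odd)})⁻¹, gives the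
-- right-hand side.
module Submission where

open import Defs
open import Algebra.Bundles using (CommutativeRing)
import Algebra.Construct.Pointwise as Pointwise
import Algebra.Properties.CommutativeSemigroup as CommutativeSemigroupProperties
import Algebra.Properties.Ring as RingProperties
open import Data.Bool using (Bool; true; false; if_then_else_; not; T; _∧_)
import Data.Bool.Properties as Boolₚ
open import Data.Empty using (⊥-elim)
open import Data.Integer as ℤ using (ℤ; +_; -[1+_]; ∣_∣)
import Data.Integer.Properties as ℤₚ
open import Data.List using (List; []; _∷_; _++_; map; filter; length; concatMap; downFrom; upTo; zip; cartesianProduct; cartesianProductWith)
import Data.List.Properties as Listₚ
open import Data.List.Membership.Propositional using (_∈_)
open import Data.List.Membership.Propositional.Properties
open import Data.List.Relation.Binary.Permutation.Propositional as ↭ using (_↭_; ↭-refl; ↭-sym; ↭-trans; ↭-prep; ↭-swap)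
open import Data.List.Relation.Binary.Permutation.Propositional.Properties using (shift; drop-∷; map⁺; ∈-resp-↭; All-resp-↭; ↭-length; ↭-empty-inv)
import Data.List.Relation.Binary.Permutation.Setoid.Properties as PermutationSetoid
open import Data.List.Relation.Unary.All as All using (All; []; _∷_)
import Data.List.Relation.Unary.All.Properties as Allₚ
open import Data.List.Relation.Unary.AllPairs as AllPairs using (AllPairs; []; _∷_)
import Data.List.Relation.Unary.AllPairs.Properties as AllPairsₚ
open import Data.List.Relation.Unary.Any using (here; there)
open import Data.List.Relation.Unary.Linked using (Linked; linked?)
open import Data.List.Relation.Unary.Linked.Properties using (Linked⇒AllPairs; AllPairs⇒Linked)
import Data.List.Relation.Unary.Unique.DecPropositional as UniqueDec
open import Data.List.Relation.Unary.Unique.Propositional using (Unique)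
import Data.List.Relation.Unary.Unique.Propositional.Properties as Unique
open import Data.Nat as ℕ using (ℕ; zero; suc; _∸_; _≤_; _<_; z≤n; s≤s; _≤ᵇ_; _<ᵇ_; _≡ᵇ_; ⌊_/2⌋)
import Data.Nat.DivMod as DivMod
open import Data.Nat.ListAction using (sum)
import Data.Nat.Properties as ℕₚ
open import Data.Nat.Solver using (module +-*-Solver)
open import Data.Product using (∃-syntax; _×_; _,_; proj₁; proj₂)
open import Data.Sum using (_⊎_; inj₁; inj₂)
open import Function using (_∘_; mk⇔)
open import Relation.Binary.Definitions using (Transitive; Asymmetric; tri<; tri≈; tri>)
open import Relation.Binary.PropositionalEquality as ≡ using (_≡_; _≢_)
open import Relation.Nullary using (¬_; Dec; yes; no; does)
open import Relation.Nullary.Decidable using (¬?; _×-dec_; _⊎-dec_; dec-true; dec-false; does-⇔)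
open import Relation.Unary using (Pred; Decidable)
open CommutativeSemigroupProperties ℕₚ.+-commutativeSemigroup using (x∙yz≈y∙xz; interchange)

-- The insertion is a discrete intermediate value argument. At a place of a word take the number of
-- later letters ranked before v, minus the number of earlier letters ranked after v. A v put there
-- is fixed iff this difference is 0. Along the word it goes from a nonnegative to a nonpositive
-- value and drops by 1 at every letter other than v. A letter v leaves it unchanged if v is even,
-- so 0 is always met. If v is odd it drops by 2, so 0 is skipped exactly when it goes from 1 to -1,
-- which means that this v is already fixed. Hence the two kinds of factors. For fixed w, the
-- smallest admissible b has as its i-th letter the value of `fdes` on the suffix of w starting
-- there. These values add up to `fmaj w`, and the first one is `fdes w`. The ring is arbitrary, so
-- quotients are compared after cross-multiplication, and only series with constant term 1 are
-- inverted or cancelled. The series (1+t)/(t²;q²)_{n+1} is one of these, which is why the identity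
-- determines B.

-- Power series in u and t as a commutative ring, and their inverses

module PowerSeries {c ℓ} (R : CommutativeRing c ℓ) where
  open CommutativeRing R
  open import Algebra.Solver.Ring.NaturalCoefficients.Default commutativeSemiring
    using (solve; _:+_; _:*_; _:=_)
  open import Relation.Binary.Reasoning.Setoid setoid

  Seq : Set c
  Seq = ℕ → Carrier

  tail : Seq → Seq
  tail f n = f (suc n)

  1ˢ : Seq
  1ˢ zero = 1#
  1ˢ (suc n) = 0#

  infixl 7 _∗_
  -- The Cauchy product by recursion on the first factor. Without subtraction of indices the ring
  -- laws are inductions on the degree.
  _∗_ : Seq → Seq → Seq
  (f ∗ g) zero = f 0 * g 0
  (f ∗ g) (suc n) = f 0 * g (suc n) + (tail f ∗ g) n

  ∗-cong : ∀ {f g h k} → (∀ n → f n ≈ g n) → (∀ n → h n ≈ k n) → ∀ n → (f ∗ h) n ≈ (g ∗ k) n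
  ∗-cong p r zero = *-cong (p 0) (r 0)
  ∗-cong p r (suc n) = +-cong (*-cong (p 0) (r (suc n))) (∗-cong (λ i → p (suc i)) r n)

  zero-∗ : ∀ {f} g → (∀ n → f n ≈ 0#) → ∀ n → (f ∗ g) n ≈ 0#
  zero-∗ g p zero = trans (*-congʳ (p 0)) (zeroˡ _)
  zero-∗ g p (suc n) =
    trans (+-cong (trans (*-congʳ (p 0)) (zeroˡ _)) (zero-∗ g (λ i → p (suc i)) n)) (+-identityˡ _)

  ∗-suc : ∀ f g n → (f ∗ g) (suc n) ≈ (f ∗ tail g) n + f (suc n) * g 0
  ∗-suc f g zero = refl
  ∗-suc f g (suc n) = trans (+-congˡ (∗-suc (tail f) g n)) (sym (+-assoc _ _ _))

  ∗-comm : ∀ f g n → (f ∗ g) n ≈ (g ∗ f) n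
  ∗-comm f g zero = *-comm _ _
  ∗-comm f g (suc n) = begin
    f 0 * g (suc n) + (tail f ∗ g) n  ≈⟨ +-cong (*-comm _ _) (∗-comm (tail f) g n) ⟩
    g (suc n) * f 0 + (g ∗ tail f) n  ≈⟨ +-comm _ _ ⟩
    (g ∗ tail f) n + g (suc n) * f 0  ≈⟨ ∗-suc g f n ⟨
    (g ∗ f) (suc n)                   ∎

  ∗-distribʳ : ∀ h f g n → ((λ i → f i + g i) ∗ h) n ≈ (f ∗ h) n + (g ∗ h) n
  ∗-distribʳ h f g zero = distribʳ _ _ _
  ∗-distribʳ h f g (suc n) = trans (+-cong (distribʳ _ _ _) (∗-distribʳ h (tail f) (tail g) n))
    (solve 4 (λ a b x y → (a :+ b) :+ (x :+ y) := (a :+ x) :+ (b :+ y)) refl _ _ _ _)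

  ∗-distribˡ : ∀ h f g n → (h ∗ (λ i → f i + g i)) n ≈ (h ∗ f) n + (h ∗ g) n
  ∗-distribˡ h f g n = trans (∗-comm h _ n)
    (trans (∗-distribʳ h f g n) (+-cong (∗-comm f h n) (∗-comm g h n)))

  scalar-∗ : ∀ a f g n → ((λ i → a * f i) ∗ g) n ≈ a * (f ∗ g) n
  scalar-∗ a f g zero = *-assoc _ _ _
  scalar-∗ a f g (suc n) =
    trans (+-cong (*-assoc _ _ _) (scalar-∗ a (tail f) g n)) (sym (distribˡ _ _ _))

  ∗-assoc : ∀ f g h n → ((f ∗ g) ∗ h) n ≈ (f ∗ (g ∗ h)) n
  ∗-assoc f g h zero = *-assoc _ _ _
  ∗-assoc f g h (suc n) = begin
    f 0 * g 0 * h (suc n) + ((λ i → f 0 * g (suc i) + (tail f ∗ g) i) ∗ h) n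
      ≈⟨ +-congˡ (∗-distribʳ h (λ i → f 0 * g (suc i)) (tail f ∗ g) n) ⟩
    f 0 * g 0 * h (suc n) + (((λ i → f 0 * g (suc i)) ∗ h) n + ((tail f ∗ g) ∗ h) n)
      ≈⟨ +-congˡ (+-cong (scalar-∗ (f 0) (tail g) h n) (∗-assoc (tail f) g h n)) ⟩
    f 0 * g 0 * h (suc n) + (f 0 * (tail g ∗ h) n + (tail f ∗ (g ∗ h)) n)
      ≈⟨ solve 5 (λ a b x y z → a :* b :* x :+ (a :* y :+ z) := a :* (b :* x :+ y) :+ z) refl
           (f 0) (g 0) (h (suc n)) ((tail g ∗ h) n) ((tail f ∗ (g ∗ h)) n) ⟩
    f 0 * (g 0 * h (suc n) + (tail g ∗ h) n) + (tail f ∗ (g ∗ h)) n  ∎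

  ∗-identityˡ : ∀ f n → (1ˢ ∗ f) n ≈ f n
  ∗-identityˡ f zero = *-identityˡ _
  ∗-identityˡ f (suc n) =
    trans (+-cong (*-identityˡ _) (zero-∗ f (λ _ → refl) n)) (+-identityʳ _)

  commutativeRingˢ : CommutativeRing c ℓ
  commutativeRingˢ = record
    { Carrier = Seq
    ; _≈_ = λ f g → ∀ n → f n ≈ g n
    ; _+_ = λ f g n → f n + g n
    ; _*_ = _∗_
    ; -_ = λ f n → - f n
    ; 0# = λ _ → 0#
    ; 1# = 1ˢ
    ; isCommutativeRing = record
      { isRing = record
        { +-isAbelianGroup = Pointwise.isAbelianGroup ℕ +-isAbelianGroup
        ; *-cong = ∗-cong
        ; *-assoc = ∗-assoc
        ; *-identity = ∗-identityˡ , λ f n → trans (∗-comm f 1ˢ n) (∗-identityˡ f n)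
        ; distrib = ∗-distribˡ , ∗-distribʳ
        }
      ; *-comm = ∗-comm
      }
    }

module FiniteSums {c ℓ} (R : CommutativeRing c ℓ) where
  open CommutativeRing R
  open Series R using (Σ≤)
  open PowerSeries R using (_∗_; tail)

  Σ≤-cong : ∀ n {f g} → (∀ i → i ≤ n → f i ≈ g i) → Σ≤ n f ≈ Σ≤ n g
  Σ≤-cong zero p = p 0 z≤n
  Σ≤-cong (suc n) p = +-cong (Σ≤-cong n (λ i i≤n → p i (ℕₚ.m≤n⇒m≤1+n i≤n))) (p (suc n) ℕₚ.≤-refl)

  Σ≤-zero : ∀ n {f} → (∀ i → i ≤ n → f i ≈ 0#) → Σ≤ n f ≈ 0#
  Σ≤-zero zero p = p 0 z≤n
  Σ≤-zero (suc n) p =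
    trans (+-cong (Σ≤-zero n (λ i i≤n → p i (ℕₚ.m≤n⇒m≤1+n i≤n))) (p (suc n) ℕₚ.≤-refl)) (+-identityˡ _)

  Σ≤-* : ∀ n a f → Σ≤ n (λ i → a * f i) ≈ a * Σ≤ n f
  Σ≤-* zero a f = refl
  Σ≤-* (suc n) a f = trans (+-congʳ (Σ≤-* n a f)) (sym (distribˡ _ _ _))

  Σ≤-head : ∀ n f → Σ≤ (suc n) f ≈ f 0 + Σ≤ n (f ∘ suc)
  Σ≤-head zero f = refl
  Σ≤-head (suc n) f = trans (+-congʳ (Σ≤-head n f)) (+-assoc _ _ _)

  Σ≤-last : ∀ n {f} → (∀ i → i < n → f i ≈ 0#) → Σ≤ n f ≈ f n
  Σ≤-last zero p = refl
  Σ≤-last (suc n) p = trans (+-congʳ (Σ≤-zero n (λ i i≤n → p i (s≤s i≤n)))) (+-identityˡ _)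

  Σ≤-extend : ∀ {m n f} → m ≤ n → (∀ i → m < i → f i ≈ 0#) → Σ≤ m f ≈ Σ≤ n f
  Σ≤-extend {m} {f = f} m≤n p = go (ℕₚ.≤⇒≤′ m≤n)
    where
    go : ∀ {n} → m ℕ.≤′ n → Σ≤ m f ≈ Σ≤ n f
    go ℕ.≤′-refl = refl
    go (ℕ.≤′-step q) =
      trans (go q) (sym (trans (+-congˡ (p _ (s≤s (ℕₚ.≤′⇒≤ q)))) (+-identityʳ _)))

  convolution : ∀ n f g → Σ≤ n (λ a → f a * g (n ∸ a)) ≈ (f ∗ g) n
  convolution zero f g = refl
  convolution (suc n) f g = trans (Σ≤-head n _) (+-congˡ (convolution n (tail f) g))

module SeriesRing {c ℓ} (R : CommutativeRing c ℓ) where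
  open CommutativeRing R using (Carrier; _≈_; 0#; 1#; refl; sym; trans; +-cong; *-cong; +-congˡ;
    *-congʳ; zeroˡ; zeroʳ; +-identityʳ; -‿cong; -‿inverseʳ)
    renaming (_+_ to _+ʳ_; _*_ to _*ʳ_)
  open Series R
  open FiniteSums R
  private
    R₁ = PowerSeries.commutativeRingˢ R
    module P₁ = PowerSeries R
    module P₂ = PowerSeries R₁
    module S₁ = Series R₁
    module R₂ = CommutativeRing P₂.commutativeRingˢ

  Σ≤-eval : ∀ n (f : ℕ → ℕ → Carrier) j → S₁.Σ≤ n f j ≡.≡ Σ≤ n (λ i → f i j)
  Σ≤-eval zero f j = ≡.refl
  Σ≤-eval (suc n) f j = ≡.cong (_+ʳ f (suc n) j) (Σ≤-eval n f j)

  -- A series in u and t is a power series in u over the ring of power series in t. The double sum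
  -- is then a nested Cauchy product, from which `_⊗_` inherits all ring laws.
  ⊗≋∗ : ∀ F G → (F ⊗ G) ≋ (F P₂.∗ G)
  ⊗≋∗ F G i j =
    trans (Σ≤-cong i (λ a _ → convolution j (F a) (G (i ∸ a))))
      (trans (CommutativeRing.reflexive R (≡.sym (Σ≤-eval i (λ a → F a P₁.∗ G (i ∸ a)) j)))
        (FiniteSums.convolution R₁ i F G j))

  one≋1 : one ≋ P₂.1ˢ
  one≋1 zero zero = refl
  one≋1 zero (suc j) = refl
  one≋1 (suc i) j = refl

  ⊗-cong : ∀ {F G H K} → F ≋ G → H ≋ K → (F ⊗ H) ≋ (G ⊗ K)
  ⊗-cong {F} {G} {H} {K} p q i j = Σ≤-cong i (λ a _ → Σ≤-cong j (λ b _ → *-cong (p _ _) (q _ _)))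

  seriesRing : CommutativeRing c ℓ
  seriesRing = record
    { Carrier = Ser
    ; _≈_ = _≋_
    ; _+_ = _⊕_
    ; _*_ = _⊗_
    ; -_ = R₂.-_
    ; 0# = R₂.0#
    ; 1# = one
    ; isCommutativeRing = record
      { isRing = record
        { +-isAbelianGroup = R₂.+-isAbelianGroup
        ; *-cong = ⊗-cong
        ; *-assoc = λ F G H → R₂.trans (via (F ⊗ G) H (⊗≋∗ F G) R₂.refl)
            (R₂.trans (R₂.*-assoc F G H) (R₂.sym (via F (G ⊗ H) R₂.refl (⊗≋∗ G H))))
        ; *-identity = (λ F → R₂.trans (via one F one≋1 R₂.refl) (R₂.*-identityˡ F))
                     , (λ F → R₂.trans (via F one R₂.refl one≋1) (R₂.*-identityʳ F))
        ; distrib = (λ F G H → R₂.trans (⊗≋∗ F (G ⊕ H)) (R₂.trans (R₂.distribˡ F G H)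
                        (R₂.sym (R₂.+-cong (⊗≋∗ F G) (⊗≋∗ F H)))))
                  , (λ F G H → R₂.trans (⊗≋∗ (G ⊕ H) F) (R₂.trans (R₂.distribʳ F G H)
                        (R₂.sym (R₂.+-cong (⊗≋∗ G F) (⊗≋∗ H F)))))
        }
      ; *-comm = λ F G → R₂.trans (⊗≋∗ F G) (R₂.trans (R₂.*-comm F G) (R₂.sym (⊗≋∗ G F)))
      }
    }
    where
    via : ∀ F G {F′ G′} → F ≋ F′ → G ≋ G′ → (F ⊗ G) ≋ (F′ P₂.∗ G′)
    via F G {F′} {G′} p q = R₂.trans (⊗≋∗ F G) (R₂.*-cong {F} {F′} {G} {G′} p q)

  private
    module S = CommutativeRing seriesRing

  -- Each factor without constant term raises the total degree by at least one.
  powS-vanish : ∀ G → G 0 0 ≈ 0# → ∀ k i j → i ℕ.+ j < k → powS G k i j ≈ 0#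
  powS-vanish G G₀ (suc k) i j (s≤s i+j≤k) = Σ≤-zero i λ a a≤i → Σ≤-zero j λ b b≤j → term a b a≤i b≤j
    where
    term : ∀ a b → a ≤ i → b ≤ j → G a b *ʳ powS G k (i ∸ a) (j ∸ b) ≈ 0#
    term zero zero _ _ = trans (*-congʳ G₀) (zeroˡ _)
    term zero (suc b) _ b<j = trans (*-cong refl (powS-vanish G G₀ k i (j ∸ suc b)
      (ℕₚ.<-≤-trans (ℕₚ.+-monoʳ-< i (ℕₚ.∸-monoʳ-< (s≤s z≤n) b<j)) i+j≤k))) (zeroʳ _)
    term (suc a) b a<i b≤j = trans (*-cong refl (powS-vanish G G₀ k (i ∸ suc a) (j ∸ b)
      (ℕₚ.<-≤-trans (ℕₚ.+-mono-<-≤ (ℕₚ.∸-monoʳ-< (s≤s z≤n) a<i) (ℕₚ.m∸n≤m j b)) i+j≤k))) (zeroʳ _)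

  geometric : Ser → ℕ → Ser
  geometric G N i j = Σ≤ N (λ k → powS G k i j)

  geometric-telescope : ∀ F N → (F ⊗ geometric (one ⊖ F) N ⊕ powS (one ⊖ F) (suc N)) ≋ one
  geometric-telescope F N = go N
    where
    open import Relation.Binary.Reasoning.Setoid S.setoid
    open import Algebra.Solver.Ring.NaturalCoefficients.Default S.commutativeSemiring
      using (solve; _:+_; _:*_; _:=_)
    G = one ⊖ F
    F+G : (F ⊕ G) ≋ one
    F+G i j = trans (CommutativeRing.+-comm R _ _)
      (trans (CommutativeRing.+-assoc R _ _ _)
        (trans (+-congˡ (CommutativeRing.-‿inverseˡ R _)) (+-identityʳ _)))
    go : ∀ N → (F ⊗ geometric G N ⊕ powS G (suc N)) ≋ one
    go zero = begin
      F ⊗ one ⊕ G ⊗ one  ≈⟨ S.distribʳ one F G ⟨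
      (F ⊕ G) ⊗ one      ≈⟨ S.*-identityʳ (F ⊕ G) ⟩
      F ⊕ G              ≈⟨ F+G ⟩
      one                ∎
    go (suc N) = begin
      F ⊗ (geometric G N ⊕ powS G (suc N)) ⊕ G ⊗ powS G (suc N)
        ≈⟨ solve 4 (λ f s g p → f :* (s :+ p) :+ g :* p := f :* s :+ (f :+ g) :* p) S.refl
             F (geometric G N) G (powS G (suc N)) ⟩
      F ⊗ geometric G N ⊕ (F ⊕ G) ⊗ powS G (suc N)
        ≈⟨ S.+-cong {F ⊗ geometric G N} S.refl (S.trans
            (⊗-cong {H = powS G (suc N)} {powS G (suc N)} F+G S.refl) (S.*-identityˡ (powS G (suc N)))) ⟩
      F ⊗ geometric G N ⊕ powS G (suc N)
        ≈⟨ go N ⟩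
      one  ∎

  -- The coefficients of `inv F` are cut off at different lengths. All those that enter the
  -- coefficient of u^i t^j have total degree at most i + j, so by `powS-vanish` they may all be cut
  -- off at i + j, and the geometric sum telescopes.
  inv-correct : ∀ F → F 0 0 ≈ 1# → (F ⊗ inv F) ≋ one
  inv-correct F F₀ i j = begin
    (F ⊗ inv F) i j
      ≈⟨ Σ≤-cong i (λ a _ → Σ≤-cong j (λ b _ → *-cong refl (stable (i ∸ a) (j ∸ b)
           (ℕₚ.+-mono-≤ (ℕₚ.m∸n≤m i a) (ℕₚ.m∸n≤m j b))))) ⟩
    (F ⊗ geometric G (i ℕ.+ j)) i j
      ≈⟨ +-identityʳ _ ⟨
    (F ⊗ geometric G (i ℕ.+ j)) i j +ʳ 0#
      ≈⟨ +-congˡ (powS-vanish G G₀ (suc (i ℕ.+ j)) i j ℕₚ.≤-refl) ⟨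
    (F ⊗ geometric G (i ℕ.+ j) ⊕ powS G (suc (i ℕ.+ j))) i j
      ≈⟨ geometric-telescope F (i ℕ.+ j) i j ⟩
    one i j  ∎
    where
    open import Relation.Binary.Reasoning.Setoid (CommutativeRing.setoid R)
    G = one ⊖ F
    G₀ : G 0 0 ≈ 0#
    G₀ = trans (+-congˡ (-‿cong F₀)) (-‿inverseʳ 1#)
    stable : ∀ a b → a ℕ.+ b ≤ i ℕ.+ j → inv F a b ≈ geometric G (i ℕ.+ j) a b
    stable a b p = Σ≤-extend p (λ k → powS-vanish G G₀ k a b)

-- Lists without repetition, tuples, and sums along bijections

module _ {a} {A : Set a} where

  ∈⇒↭∷ : ∀ {x : A} {xs} → x ∈ xs → ∃[ ys ] xs ↭ x ∷ ys
  ∈⇒↭∷ x∈xs with ys , zs , ≡.refl ← ∈-∃++ x∈xs = ys ++ zs , shift _ ys zs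

  Unique-resp-↭ : ∀ {xs ys : List A} → xs ↭ ys → Unique xs → Unique ys
  Unique-resp-↭ = PermutationSetoid.Unique-resp-↭ (≡.setoid A) ∘ ↭.↭⇒↭ₛ

  ∈-tail : ∀ {x y : A} {xs} → x ∈ y ∷ xs → x ≢ y → x ∈ xs
  ∈-tail (here x≡y) x≢y = ⊥-elim (x≢y x≡y)
  ∈-tail (there x∈xs) _ = x∈xs

  -- Pigeonhole: the elements of `xs` are taken out of `ys` one by one, and the bound on the length
  -- leaves nothing over.
  ⊆∧length⇒↭ : ∀ {xs ys : List A} → Unique xs → (∀ {x} → x ∈ xs → x ∈ ys) →
               length ys ≤ length xs → xs ↭ ys
  ⊆∧length⇒↭ {[]} {[]} u s l = ↭.refl
  ⊆∧length⇒↭ {x ∷ xs} (x∉ ∷ u) s l with ys′ , p ← ∈⇒↭∷ (s (here ≡.refl)) =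
    ↭-trans (↭-prep x (⊆∧length⇒↭ u
      (λ z∈xs → ∈-tail (∈-resp-↭ p (s (there z∈xs))) (λ z≡x → All.lookup x∉ z∈xs (≡.sym z≡x)))
      (ℕₚ.≤-pred (ℕₚ.≤-trans (ℕₚ.≤-reflexive (≡.sym (↭-length p))) l)))) (↭-sym p)

  tuples : List A → ℕ → List (List A)
  tuples xs zero = [] ∷ []
  tuples xs (suc k) = cartesianProductWith _∷_ xs (tuples xs k)

  tuples-unique : ∀ {xs} → Unique xs → ∀ k → Unique (tuples xs k)
  tuples-unique u zero = [] ∷ []
  tuples-unique u (suc k) = Unique.cartesianProductWith⁺ _∷_ Listₚ.∷-injective u (tuples-unique u k)

  ∈-tuples⁺ : ∀ {xs ws} → All (_∈ xs) ws → ws ∈ tuples xs (length ws)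
  ∈-tuples⁺ [] = here ≡.refl
  ∈-tuples⁺ (w∈ ∷ ws∈) = ∈-cartesianProductWith⁺ _∷_ w∈ (∈-tuples⁺ ws∈)

  ∈-tuples⁻ : ∀ {xs} k {ws} → ws ∈ tuples xs k → length ws ≡ k × All (_∈ xs) ws
  ∈-tuples⁻ zero (here ≡.refl) = ≡.refl , []
  ∈-tuples⁻ {xs} (suc k) p with _ , _ , w∈ , ws∈ , ≡.refl ← ∈-cartesianProductWith⁻ _∷_ xs (tuples xs k) p
    with l , ws⊆ ← ∈-tuples⁻ k ws∈ = ≡.cong suc l , w∈ ∷ ws⊆

concatMap-map : ∀ {a b c} {A : Set a} {B : Set b} {C : Set c} (f : A → B → C) xs ys →
                concatMap (λ x → map (f x) ys) xs ≡ cartesianProductWith f xs ys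
concatMap-map f [] ys = ≡.refl
concatMap-map f (x ∷ xs) ys = ≡.cong (map (f x) ys ++_) (concatMap-map f xs ys)

module ListSums {c ℓ} (R : CommutativeRing c ℓ) where
  open CommutativeRing R
  open Series R using (Σ≤; listSum)
  open import Algebra.Solver.Ring.NaturalCoefficients.Default commutativeSemiring
    using (solve; _:+_; _:=_)

  Σₗ : ∀ {a} {A : Set a} → List A → (A → Carrier) → Carrier
  Σₗ xs f = listSum (map f xs)

  module _ {a} {A : Set a} where

    Σₗ-cong : ∀ (xs : List A) {f g} → (∀ {x} → x ∈ xs → f x ≈ g x) → Σₗ xs f ≈ Σₗ xs g
    Σₗ-cong [] p = refl
    Σₗ-cong (x ∷ xs) p = +-cong (p (here ≡.refl)) (Σₗ-cong xs (p ∘ there))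

    Σₗ-+ : ∀ (xs : List A) f g → Σₗ xs (λ x → f x + g x) ≈ Σₗ xs f + Σₗ xs g
    Σₗ-+ [] f g = sym (+-identityˡ _)
    Σₗ-+ (x ∷ xs) f g = trans (+-congˡ (Σₗ-+ xs f g))
      (solve 4 (λ a b x y → (a :+ b) :+ (x :+ y) := (a :+ x) :+ (b :+ y)) refl _ _ _ _)

    Σₗ-* : ∀ (xs : List A) k f → Σₗ xs (λ x → k * f x) ≈ k * Σₗ xs f
    Σₗ-* [] k f = sym (zeroʳ k)
    Σₗ-* (x ∷ xs) k f = trans (+-congˡ (Σₗ-* xs k f)) (sym (distribˡ _ _ _))

    Σₗ-++ : ∀ (xs ys : List A) f → Σₗ (xs ++ ys) f ≈ Σₗ xs f + Σₗ ys f
    Σₗ-++ [] ys f = sym (+-identityˡ _)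
    Σₗ-++ (x ∷ xs) ys f = trans (+-congˡ (Σₗ-++ xs ys f)) (sym (+-assoc _ _ _))

    Σₗ-↭ : ∀ {xs ys : List A} f → xs ↭ ys → Σₗ xs f ≈ Σₗ ys f
    Σₗ-↭ f ↭.refl = refl
    Σₗ-↭ f (↭.prep x p) = +-congˡ (Σₗ-↭ f p)
    Σₗ-↭ f (↭.swap x y p) = trans (+-congˡ (+-congˡ (Σₗ-↭ f p)))
      (solve 3 (λ x y z → x :+ (y :+ z) := y :+ (x :+ z)) refl _ _ _)
    Σₗ-↭ f (↭.trans p q) = trans (Σₗ-↭ f p) (Σₗ-↭ f q)

    Σₗ-filter : ∀ {p} {P : Pred A p} (P? : Decidable P) xs f →
                Σₗ (filter P? xs) f ≈ Σₗ xs (λ x → if does (P? x) then f x else 0#)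
    Σₗ-filter P? [] f = refl
    Σₗ-filter P? (x ∷ xs) f with does (P? x)
    ... | true = +-congˡ (Σₗ-filter P? xs f)
    ... | false = trans (Σₗ-filter P? xs f) (sym (+-identityˡ _))

    Σₗ-split : ∀ {p} {P : Pred A p} (P? : Decidable P) xs f →
               Σₗ xs f ≈ Σₗ (filter (¬? ∘ P?) xs) f + Σₗ (filter P? xs) f
    Σₗ-split P? [] f = sym (+-identityˡ _)
    Σₗ-split P? (x ∷ xs) f with does (P? x)
    ... | true = trans (+-congˡ (Σₗ-split P? xs f))
      (solve 3 (λ x y z → x :+ (y :+ z) := y :+ (x :+ z)) refl _ _ _)
    ... | false = trans (+-congˡ (Σₗ-split P? xs f)) (sym (+-assoc _ _ _))

  Σₗ-map : ∀ {a b} {A : Set a} {B : Set b} (g : A → B) xs f → Σₗ (map g xs) f ≈ Σₗ xs (f ∘ g)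
  Σₗ-map g [] f = refl
  Σₗ-map g (x ∷ xs) f = +-congˡ (Σₗ-map g xs f)

  Σₗ-cartesianProductWith : ∀ {a b d} {A : Set a} {B : Set b} {D : Set d} (g : A → B → D) xs ys f →
    Σₗ (cartesianProductWith g xs ys) f ≈ Σₗ xs (λ x → Σₗ ys (λ y → f (g x y)))
  Σₗ-cartesianProductWith g [] ys f = refl
  Σₗ-cartesianProductWith g (x ∷ xs) ys f = trans (Σₗ-++ (map (g x) ys) _ f)
    (+-cong (Σₗ-map (g x) ys f) (Σₗ-cartesianProductWith g xs ys f))

  Σₗ-downFrom : ∀ n f → Σₗ (downFrom (suc n)) f ≈ Σ≤ n f
  Σₗ-downFrom zero f = +-identityʳ _
  Σₗ-downFrom (suc n) f = trans (+-comm _ _) (+-congʳ (Σₗ-downFrom n f))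

  -- The bijection is a relation, as inserting and sorting are both described by what they result
  -- in. The induction takes one matched pair out of both lists.
  Σₗ-correspondence : ∀ {a b r} {A : Set a} {B : Set b} (_~_ : A → B → Set r) xs ys {f g} →
    Unique xs → Unique ys →
    (∀ {x} → x ∈ xs → ∃[ y ] y ∈ ys × x ~ y) →
    (∀ {y} → y ∈ ys → ∃[ x ] x ∈ xs × x ~ y) →
    (∀ {x x′ y} → x ~ y → x′ ~ y → x ≡ x′) →
    (∀ {x y y′} → x ~ y → x ~ y′ → y ≡ y′) →
    (∀ {x y} → x ∈ xs → x ~ y → f x ≈ g y) →
    Σₗ xs f ≈ Σₗ ys g
  Σₗ-correspondence _~_ [] [] ux uy t s i₁ i₂ e = refl
  Σₗ-correspondence _~_ [] (y ∷ ys) ux uy t s i₁ i₂ e with () ← proj₁ (proj₂ (s (here ≡.refl)))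
  Σₗ-correspondence _~_ (x ∷ xs) ys {f} {g} (x∉ ∷ ux) uy t s i₁ i₂ e
    with y , y∈ys , x~y ← t (here ≡.refl) with ys′ , p ← ∈⇒↭∷ y∈ys
    with y∉ ∷ uy′ ← Unique-resp-↭ p uy =
    trans (+-cong (e (here ≡.refl) x~y)
      (Σₗ-correspondence _~_ xs ys′ ux uy′ t′ s′ i₁ i₂ (e ∘ there))) (sym (Σₗ-↭ g p))
    where
    t′ : ∀ {x′} → x′ ∈ xs → ∃[ y′ ] y′ ∈ ys′ × x′ ~ y′
    t′ x′∈xs with y′ , y′∈ys , x′~y′ ← t (there x′∈xs) = y′
      , ∈-tail (∈-resp-↭ p y′∈ys) (λ { ≡.refl → All.lookup x∉ x′∈xs (i₁ x~y x′~y′) }) , x′~y′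
    s′ : ∀ {y′} → y′ ∈ ys′ → ∃[ x′ ] x′ ∈ xs × x′ ~ y′
    s′ y′∈ys′ with x′ , x′∈xs , x′~y′ ← s (∈-resp-↭ (↭-sym p) (there y′∈ys′)) = x′
      , ∈-tail x′∈xs (λ { ≡.refl → All.lookup y∉ y′∈ys′ (i₂ x~y x′~y′) }) , x′~y′

  Σₗ-tuples : ∀ {a} {A : Set a} (xs : List A) k f →
    Σₗ (tuples xs (suc k)) f ≈ Σₗ xs (λ x → Σₗ (tuples xs k) (λ ws → f (x ∷ ws)))
  Σₗ-tuples xs k = Σₗ-cartesianProductWith _∷_ xs (tuples xs k)

-- Ranks of letters, and the insertion of a fixed letter

T⇒≡true : ∀ {b} → T b → b ≡ true
T⇒≡true {true} _ = ≡.refl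

¬T⇒≡false : ∀ {b} → ¬ T b → b ≡ false
¬T⇒≡false {false} _ = ≡.refl
¬T⇒≡false {true} n = ⊥-elim (n _)

χ-true : ∀ {b} → T b → χ b ≡ 1
χ-true = ≡.cong χ ∘ T⇒≡true

χ-false : ∀ {b} → ¬ T b → χ b ≡ 0
χ-false = ≡.cong χ ∘ ¬T⇒≡false

χ-≤ : ∀ {a b} → (T a → T b) → χ a ≤ χ b
χ-≤ {false} _ = z≤n
χ-≤ {true} {true} _ = ℕₚ.≤-refl
χ-≤ {true} {false} f = ⊥-elim (f _)

above : ℕ → List ℕ → ℕ
above t [] = 0
above t (y ∷ ys) = χ (t ≤ᵇ y) ℕ.+ above t ys

below : ℕ → List ℕ → ℕ
below t [] = 0
below t (y ∷ ys) = χ (y <ᵇ t) ℕ.+ below t ys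

above-anti : ∀ {s t} ys → s ≤ t → above t ys ≤ above s ys
above-anti [] s≤t = z≤n
above-anti {s} {t} (y ∷ ys) s≤t = ℕₚ.+-mono-≤
  (χ-≤ {t ≤ᵇ y} {s ≤ᵇ y} (λ p → ℕₚ.≤⇒≤ᵇ (ℕₚ.≤-trans s≤t (ℕₚ.≤ᵇ⇒≤ t y p)))) (above-anti ys s≤t)

below-mono : ∀ {s t} ys → s ≤ t → below s ys ≤ below t ys
below-mono [] s≤t = z≤n
below-mono {s} {t} (y ∷ ys) s≤t = ℕₚ.+-mono-≤
  (χ-≤ {y <ᵇ s} {y <ᵇ t} (λ p → ℕₚ.<⇒<ᵇ (ℕₚ.<-≤-trans (ℕₚ.<ᵇ⇒< y s p) s≤t))) (below-mono ys s≤t)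

-- In the standardisation of a word the letters are ranked in decreasing order; equal
-- letters are ranked from left to right if they are even and from right to left if odd.
-- A letter a with prefix γ and suffix β is ranked at its own place iff up a β ≡ dn a γ.
upFrom downBelow : ℕ → ℕ
upFrom a = if isOdd a then a else suc a
downBelow a = if isOdd a then suc a else a

up dn : ℕ → List ℕ → ℕ
up a = above (upFrom a)
dn a = below (downBelow a)

-- The two indicators are the contributions of a to `up v` and to `dn v`. When a moves from the
-- suffix to the prefix, `up v` minus `dn v` drops by their sum: 1 if a differs from v, otherwise 0
-- for even v and 2 for odd v.
data Compared (v a : ℕ) : Set where
  less : a < v → χ (upFrom v ≤ᵇ a) ≡ 0 → χ (a <ᵇ downBelow v) ≡ 1 → Compared v a
  same : a ≡ v → χ (upFrom v ≤ᵇ a) ≡ χ (isOdd v) → χ (a <ᵇ downBelow v) ≡ χ (isOdd v) → Compared v a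
  more : v < a → χ (upFrom v ≤ᵇ a) ≡ 1 → χ (a <ᵇ downBelow v) ≡ 0 → Compared v a

upFrom-≥ : ∀ v → v ≤ upFrom v
upFrom-≥ v with isOdd v
... | true = ℕₚ.≤-refl
... | false = ℕₚ.n≤1+n v

upFrom-≤ : ∀ v → upFrom v ≤ suc v
upFrom-≤ v with isOdd v
... | true = ℕₚ.n≤1+n v
... | false = ℕₚ.≤-refl

downBelow-≥ : ∀ v → v ≤ downBelow v
downBelow-≥ v with isOdd v
... | true = ℕₚ.n≤1+n v
... | false = ℕₚ.≤-refl

downBelow-≤ : ∀ v → downBelow v ≤ suc v
downBelow-≤ v with isOdd v
... | true = ℕₚ.≤-refl
... | false = ℕₚ.n≤1+n v

upFrom-self : ∀ v → χ (upFrom v ≤ᵇ v) ≡ χ (isOdd v)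
upFrom-self v with isOdd v
... | true = χ-true (ℕₚ.≤⇒≤ᵇ (ℕₚ.≤-refl {v}))
... | false = χ-false (ℕₚ.<-irrefl ≡.refl ∘ ℕₚ.≤ᵇ⇒≤ (suc v) v)

downBelow-self : ∀ v → χ (v <ᵇ downBelow v) ≡ χ (isOdd v)
downBelow-self v with isOdd v
... | true = χ-true (ℕₚ.<⇒<ᵇ (ℕₚ.n<1+n v))
... | false = χ-false (ℕₚ.<-irrefl ≡.refl ∘ ℕₚ.<ᵇ⇒< v v)

compare : ∀ v a → Compared v a
compare v a with ℕₚ.<-cmp a v
... | tri< a<v _ _ = less a<v
  (χ-false (ℕₚ.<⇒≱ (ℕₚ.<-≤-trans a<v (upFrom-≥ v)) ∘ ℕₚ.≤ᵇ⇒≤ (upFrom v) a))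
  (χ-true (ℕₚ.<⇒<ᵇ (ℕₚ.<-≤-trans a<v (downBelow-≥ v))))
... | tri≈ _ ≡.refl _ = same ≡.refl (upFrom-self v) (downBelow-self v)
... | tri> _ _ v<a = more v<a
  (χ-true (ℕₚ.≤⇒≤ᵇ (ℕₚ.≤-trans (upFrom-≤ v) v<a)))
  (χ-false (ℕₚ.<⇒≱ v<a ∘ ℕₚ.≤-pred ∘ (λ p → ℕₚ.≤-trans p (downBelow-≤ v)) ∘ ℕₚ.<ᵇ⇒< a (downBelow v)))

upFrom-mono : ∀ {v a} → v ≤ a → upFrom v ≤ upFrom a
upFrom-mono {v} {a} v≤a with ℕₚ.m≤n⇒m<n∨m≡n v≤a
... | inj₂ ≡.refl = ℕₚ.≤-refl
... | inj₁ v<a = ℕₚ.≤-trans (upFrom-≤ v) (ℕₚ.≤-trans v<a (upFrom-≥ a))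

downBelow-mono : ∀ {v a} → v ≤ a → downBelow v ≤ downBelow a
downBelow-mono {v} {a} v≤a with ℕₚ.m≤n⇒m<n∨m≡n v≤a
... | inj₂ ≡.refl = ℕₚ.≤-refl
... | inj₁ v<a = ℕₚ.≤-trans (downBelow-≤ v) (ℕₚ.≤-trans v<a (downBelow-≥ a))

module _ (v : ℕ) where

  -- The word is split into a prefix γ, which may be reversed, and β; the fixed v lies in β.
  data HasFixed : List ℕ → List ℕ → Set where
    here  : ∀ {γ β} → up v β ≡ dn v γ → HasFixed γ (v ∷ β)
    there : ∀ {γ a β} → HasFixed (a ∷ γ) β → HasFixed γ (a ∷ β)

  hasFixed? : ∀ γ β → Dec (HasFixed γ β)
  hasFixed? γ [] = no λ ()
  hasFixed? γ (a ∷ β) with hasFixed? (a ∷ γ) β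
  ... | yes f = yes (there f)
  ... | no ¬f with a ℕ.≟ v
  ...   | no a≢v = no λ { (here _) → a≢v ≡.refl ; (there f) → ¬f f }
  ...   | yes ≡.refl with up v β ℕ.≟ dn v γ
  ...     | yes e = yes (here e)
  ...     | no n = no λ { (here e) → n e ; (there f) → ¬f f }

  -- The v is inserted at the first place where it becomes a fixed point.
  data Insertion : List ℕ → List ℕ → List ℕ → Set where
    here  : ∀ {γ β} → up v β ≡ dn v γ → Insertion γ β (v ∷ β)
    there : ∀ {γ a β β′} → dn v γ < up v (a ∷ β) → Insertion (a ∷ γ) β β′ →
            Insertion γ (a ∷ β) (a ∷ β′)

  insertion-≤ : ∀ {γ β β′} → Insertion γ β β′ → dn v γ ≤ up v β
  insertion-≤ (here e) = ℕₚ.≤-reflexive (≡.sym e)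
  insertion-≤ (there l _) = ℕₚ.<⇒≤ l

  insertion-above : ∀ {γ β β′} → Insertion γ β β′ → ∀ t → above t β′ ≡ χ (t ≤ᵇ v) ℕ.+ above t β
  insertion-above (here e) t = ≡.refl
  insertion-above (there {a = a} _ i) t =
    ≡.trans (≡.cong (χ (t ≤ᵇ a) ℕ.+_) (insertion-above i t)) (x∙yz≈y∙xz (χ (t ≤ᵇ a)) (χ (t ≤ᵇ v)) _)

  insertion-↭ : ∀ {γ β β′} → Insertion γ β β′ → β′ ↭ v ∷ β
  insertion-↭ (here _) = ↭-refl
  insertion-↭ (there {a = a} _ i) = ↭-trans (↭-prep a (insertion-↭ i)) (↭-swap a v ↭-refl)

  insertion-functional : ∀ {γ β β₁ β₂} → Insertion γ β β₁ → Insertion γ β β₂ → β₁ ≡ β₂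
  insertion-functional (here _) (here _) = ≡.refl
  insertion-functional (here e) (there l _) = ⊥-elim (ℕₚ.<-irrefl (≡.sym e) l)
  insertion-functional (there l _) (here e) = ⊥-elim (ℕₚ.<-irrefl (≡.sym e) l)
  insertion-functional (there _ i) (there _ j) = ≡.cong (_ ∷_) (insertion-functional i j)

  -- The inserted v is the first fixed v of the result. If v goes in behind an equal letter, the
  -- inequality recorded at that letter says that it is not fixed, because in the count `up v` the
  -- new v makes up for the letter passed.
  insertion-injective : ∀ {γ β₁ β₂ β′} → Insertion γ β₁ β′ → Insertion γ β₂ β′ → β₁ ≡ β₂
  insertion-injective (here _) (here _) = ≡.refl
  insertion-injective (here e) (there l i) =
    ⊥-elim (ℕₚ.<-irrefl (≡.sym (≡.trans (≡.sym (insertion-above i (upFrom v))) e)) l)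
  insertion-injective (there l i) (here e) =
    ⊥-elim (ℕₚ.<-irrefl (≡.sym (≡.trans (≡.sym (insertion-above i (upFrom v))) e)) l)
  insertion-injective (there _ i) (there _ j) = ≡.cong (_ ∷_) (insertion-injective i j)

  up-self : ∀ β → up v (v ∷ β) ≡ χ (isOdd v) ℕ.+ up v β
  up-self β = ≡.cong (ℕ._+ up v β) (upFrom-self v)

  -- Right before a fixed v the difference of `up v` and `dn v` is 1 for odd v and 0 for even v, and
  -- it was not smaller at any earlier place.
  hasFixed-≤ : ∀ {γ β} → HasFixed γ β → χ (isOdd v) ℕ.+ dn v γ ≤ up v β
  hasFixed-≤ (here {γ} {β} e) =
    ℕₚ.≤-reflexive (≡.trans (≡.cong (χ (isOdd v) ℕ.+_) (≡.sym e)) (≡.sym (up-self β)))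
  hasFixed-≤ (there {γ} {a} {β} f) = ℕₚ.≤-trans (ℕₚ.+-monoʳ-≤ (χ (isOdd v)) (ℕₚ.m≤n+m _ _))
    (ℕₚ.≤-trans (hasFixed-≤ f) (ℕₚ.m≤n+m _ (χ (upFrom v ≤ᵇ a))))

  insertion⇒hasFixed : ∀ {γ β β′} → Insertion γ β β′ → HasFixed γ β′
  insertion⇒hasFixed (here e) = here e
  insertion⇒hasFixed (there _ i) = there (insertion⇒hasFixed i)

  -- For odd v the difference is at least 1 before a fixed v and at most -1 behind it, so no place
  -- with difference 0 remains.
  insertion-odd : isOdd v ≡ true → ∀ {γ β β′} → Insertion γ β β′ → ¬ HasFixed γ β
  insertion-odd o {γ} (here e) f = ℕₚ.<-irrefl ≡.refl
    (≡.subst₂ _≤_ (≡.cong (λ b → χ b ℕ.+ dn v γ) o) e (hasFixed-≤ f))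
  insertion-odd o (there l i) (there f) = insertion-odd o i f
  insertion-odd o {γ} (there l i) (here e) = ℕₚ.<-irrefl ≡.refl
    (≡.subst₂ _≤_ (≡.cong (ℕ._+ dn v γ) (≡.trans (downBelow-self v) (≡.cong χ o))) e (insertion-≤ i))

  -- The inequality is the invariant of the walk. At the empty suffix it forces equality, so the
  -- search succeeds there at the latest.
  insert : ∀ γ β → dn v γ ≤ up v β → (isOdd v ≡ true → ¬ HasFixed γ β) → ∃[ β′ ] Insertion γ β β′
  insert γ [] l n = v ∷ [] , here (≡.sym (ℕₚ.n≤0⇒n≡0 l))
  insert γ (a ∷ β) l n with up v (a ∷ β) ℕ.≟ dn v γ
  ... | yes e = v ∷ a ∷ β , here e
  ... | no n′ = let β′ , i = insert (a ∷ γ) β step (λ o f → n o (there f)) in a ∷ β′ , there l′ i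
    where
    l′ : dn v γ < up v (a ∷ β)
    l′ = ℕₚ.≤∧≢⇒< l (n′ ∘ ≡.sym)
    step : dn v (a ∷ γ) ≤ up v β
    step with compare v a | l′
    ... | less _ u d | l′ rewrite u | d = l′
    ... | more _ u d | l′ rewrite u | d = ℕₚ.≤-pred l′
    ... | same ≡.refl u d | l′ rewrite u | d = odd-case (isOdd v) (λ o e → n o (here (≡.sym e))) l′
      where
      -- An odd v lowers the difference by 2. This would violate the invariant only from the value
      -- 1, and then this v would be fixed.
      odd-case : ∀ o → (o ≡ true → dn v γ ≢ up v β) → dn v γ < χ o ℕ.+ up v β → χ o ℕ.+ dn v γ ≤ up v β
      odd-case false _ l = ℕₚ.<⇒≤ l
      odd-case true n l = ℕₚ.≤∧≢⇒< (ℕₚ.≤-pred l) (n ≡.refl)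

  -- The inequality at each letter passed must be recovered from `hasFixed-≤` for the longer word.
  -- The χ in that bound is what the removed v contributes to `up v`. It cancels when another letter
  -- is passed, while a passed v that is not fixed makes up for the removed one.
  remove : ∀ γ β′ → HasFixed γ β′ → ∃[ β ] Insertion γ β β′
  remove γ .(v ∷ _) (here e) = _ , here e
  remove γ (a ∷ β″) (there f) with a ℕ.≟ v | up v β″ ℕ.≟ dn v γ
  ... | yes ≡.refl | yes e = _ , here e
  ... | yes ≡.refl | no n = let β , i = remove (a ∷ γ) β″ f in a ∷ β , there
      (bound {β} (hasFixed-≤ f) (insertion-above i (upFrom v))) i
    where
    bound : ∀ {β} → χ (isOdd v) ℕ.+ dn v (v ∷ γ) ≤ up v β″ → up v β″ ≡ χ (upFrom v ≤ᵇ v) ℕ.+ up v β →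
            dn v γ < up v (v ∷ β)
    bound {β} l e rewrite downBelow-self v = ≡.subst (dn v γ <_) e (strict (isOdd v) l)
      where
      strict : ∀ o → χ o ℕ.+ (χ o ℕ.+ dn v γ) ≤ up v β″ → dn v γ < up v β″
      strict false l = ℕₚ.≤∧≢⇒< l (n ∘ ≡.sym)
      strict true l = ℕₚ.<⇒≤ l
  remove γ (a ∷ β″) (there f) | no a≢v | _ = let β , i = remove (a ∷ γ) β″ f in a ∷ β , there
      (bound {β} (hasFixed-≤ f) (insertion-above i (upFrom v))) i
    where
    bound : ∀ {β} → χ (isOdd v) ℕ.+ dn v (a ∷ γ) ≤ up v β″ → up v β″ ≡ χ (upFrom v ≤ᵇ v) ℕ.+ up v β →
            dn v γ < up v (a ∷ β)
    bound {β} l e with ℕₚ.+-cancelˡ-≤ (χ (isOdd v)) _ _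
        (ℕₚ.≤-trans l (ℕₚ.≤-reflexive (≡.trans e (up-self β)))) | compare v a
    ... | l′ | less _ u d rewrite u | d = l′
    ... | l′ | more _ u d rewrite u | d = s≤s l′
    ... | l′ | same a≡v _ _ = ⊥-elim (a≢v a≡v)

≡ᵇ-false : ∀ {m n} → m ≢ n → (m ≡ᵇ n) ≡ false
≡ᵇ-false {m} {n} m≢n = ¬T⇒≡false (m≢n ∘ ℕₚ.≡ᵇ⇒≡ m n)

≡ᵇ-true : ∀ {m n} → m ≡ n → (m ≡ᵇ n) ≡ true
≡ᵇ-true {m} {n} m≡n = T⇒≡true (ℕₚ.≡⇒≡ᵇ m n m≡n)

-- Weights that mark fixed letters, and their behaviour under insertion

module FixedPointWeights {c ℓ} (R : CommutativeRing c ℓ) (x : ℕ → CommutativeRing.Carrier R) where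
  open CommutativeRing R
  open ListSums R
  open import Algebra.Solver.Ring.NaturalCoefficients.Default commutativeSemiring
    using (solve; _:*_; _:=_)

  mark : Bool → Carrier → Carrier
  mark b y = if b then y else 1#

  weight : (ℕ → Carrier) → List ℕ → List ℕ → Carrier
  weight Y γ [] = 1#
  weight Y γ (a ∷ β) = x a * mark (up a β ≡ᵇ dn a γ) (Y a) * weight Y (a ∷ γ) β

  module _ (v : ℕ) where

    -- Here γ′ stands for the prefix γ with v added. It changes `dn a` only for a > v, or for a = v
    -- odd. Such a letter counts in `up v`, so for the rest β behind it
    -- `up a β ≤ up v β < dn v γ ≤ dn a γ`, and it is fixed neither with nor without the new v.
    weight-after : ∀ Y β {γ γ′} → (∀ t → below t γ′ ≡ χ (v <ᵇ t) ℕ.+ below t γ) → up v β ≤ dn v γ →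
                   weight Y γ′ β ≈ weight Y γ β
    weight-after Y [] p l = refl
    weight-after Y (a ∷ β) {γ} {γ′} p l =
      *-cong (*-congˡ (reflexive (≡.cong (λ b → mark b (Y a)) flags)))
        (weight-after Y β p′ (ℕₚ.≤-trans (ℕₚ.m≤n+m _ (χ (upFrom v ≤ᵇ a))) (ℕₚ.≤-trans l (ℕₚ.m≤n+m _ _))))
      where
      p′ : ∀ t → below t (a ∷ γ′) ≡ χ (v <ᵇ t) ℕ.+ below t (a ∷ γ)
      p′ t = ≡.trans (≡.cong (χ (a <ᵇ t) ℕ.+_) (p t)) (x∙yz≈y∙xz (χ (a <ᵇ t)) (χ (v <ᵇ t)) _)
      differ : χ (upFrom v ≤ᵇ a) ≡ 1 → v ≤ a → up a β < dn a γ
      differ e v≤a = ℕₚ.≤-trans (s≤s (above-anti β (upFrom-mono v≤a)))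
        (ℕₚ.≤-trans (≡.subst (λ k → k ℕ.+ up v β ≤ dn v γ) e l) (below-mono γ (downBelow-mono v≤a)))
      unequal : up a β < dn a γ → (up a β ≡ᵇ dn a γ′) ≡ (up a β ≡ᵇ dn a γ)
      unequal l = ≡.trans
        (≡ᵇ-false (ℕₚ.<⇒≢ (ℕₚ.<-≤-trans l (≡.subst (dn a γ ≤_) (≡.sym (p (downBelow a))) (ℕₚ.m≤n+m _ _)))))
        (≡.sym (≡ᵇ-false (ℕₚ.<⇒≢ l)))
      flags : (up a β ≡ᵇ dn a γ′) ≡ (up a β ≡ᵇ dn a γ)
      flags with compare a v | compare v a
      ... | more _ _ d | _ = ≡.cong (up a β ≡ᵇ_) (≡.trans (p (downBelow a)) (≡.cong (ℕ._+ dn a γ) d))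
      ... | less v<a _ _ | less a<v _ _ = ⊥-elim (ℕₚ.<-asym v<a a<v)
      ... | less v<a _ _ | same ≡.refl _ _ = ⊥-elim (ℕₚ.<-irrefl ≡.refl v<a)
      ... | less v<a _ _ | more _ u _ = unequal (differ u (ℕₚ.<⇒≤ v<a))
      ... | same ≡.refl u d | _ = by-parity (isOdd a) ≡.refl
        where
        by-parity : ∀ o → isOdd a ≡ o → (up a β ≡ᵇ dn a γ′) ≡ (up a β ≡ᵇ dn a γ)
        by-parity true o = unequal (differ (≡.trans u (≡.cong χ o)) ℕₚ.≤-refl)
        by-parity false o = ≡.cong (up a β ≡ᵇ_)
          (≡.trans (p (downBelow a)) (≡.cong (ℕ._+ dn a γ) (≡.trans d (≡.cong χ o))))

    -- The mirror image of `weight-after` handles the letters a in front of the new v. Their `up a`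
    -- changes only for a < v, or for a = v odd, and then `dn a γ ≤ dn v γ < up v β ≤ up a β`.
    weight-insertion : ∀ Y {γ β β′} → Insertion v γ β β′ → weight Y γ β′ ≈ x v * Y v * weight Y γ β
    weight-insertion Y {γ} {β} (here e) rewrite ≡ᵇ-true e =
      *-congˡ (weight-after Y β (λ t → ≡.refl) (ℕₚ.≤-reflexive e))
    weight-insertion Y {γ} (there {a = a} {β} {β′} l i) = trans
      (*-cong (*-congˡ (reflexive (≡.cong (λ b → mark b (Y a)) flags))) (weight-insertion Y i))
      (solve 5 (λ x y a b w → (a :* b) :* ((x :* y) :* w) := (x :* y) :* ((a :* b) :* w)) refl _ _ _ _ _)
      where
      differ : χ (a <ᵇ downBelow v) ≡ 1 → a ≤ v → dn a γ < up a β
      differ e a≤v = ℕₚ.≤-trans (s≤s (below-mono γ (downBelow-mono a≤v)))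
        (ℕₚ.≤-trans (≡.subst (λ k → k ℕ.+ dn v γ ≤ up v β) e (insertion-≤ v i))
            (above-anti β (upFrom-mono a≤v)))
      above′ : up a β′ ≡ χ (upFrom a ≤ᵇ v) ℕ.+ up a β
      above′ = insertion-above v i (upFrom a)
      unequal : dn a γ < up a β → (up a β′ ≡ᵇ dn a γ) ≡ (up a β ≡ᵇ dn a γ)
      unequal l = ≡.trans
        (≡ᵇ-false (ℕₚ.<⇒≢ (ℕₚ.<-≤-trans l (≡.subst (up a β ≤_) (≡.sym above′) (ℕₚ.m≤n+m _ _))) ∘ ≡.sym))
        (≡.sym (≡ᵇ-false (ℕₚ.<⇒≢ l ∘ ≡.sym)))
      flags : (up a β′ ≡ᵇ dn a γ) ≡ (up a β ≡ᵇ dn a γ)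
      flags with compare a v | compare v a
      ... | less _ u _ | _ = ≡.cong (_≡ᵇ dn a γ) (≡.trans above′ (≡.cong (ℕ._+ up a β) u))
      ... | more a<v _ _ | more v<a _ _ = ⊥-elim (ℕₚ.<-asym v<a a<v)
      ... | more a<v _ _ | same ≡.refl _ _ = ⊥-elim (ℕₚ.<-irrefl ≡.refl a<v)
      ... | more a<v _ _ | less _ _ d = unequal (differ d (ℕₚ.<⇒≤ a<v))
      ... | same ≡.refl u d | _ = by-parity (isOdd a) ≡.refl
        where
        by-parity : ∀ o → isOdd a ≡ o → (up a β′ ≡ᵇ dn a γ) ≡ (up a β ≡ᵇ dn a γ)
        by-parity true o = unequal (differ (≡.trans d (≡.cong χ o)) ℕₚ.≤-refl)
        by-parity false o = ≡.cong (_≡ᵇ dn a γ)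
          (≡.trans above′ (≡.cong (ℕ._+ up a β) (≡.trans u (≡.cong χ o))))

    weight-unfixed : ∀ {Y Y′} → (∀ a → a ≢ v → Y a ≈ Y′ a) → ∀ {γ} β → ¬ HasFixed v γ β →
                     weight Y γ β ≈ weight Y′ γ β
    weight-unfixed p [] n = refl
    weight-unfixed {Y} {Y′} p {γ} (a ∷ β) n = *-cong (*-congˡ flag) (weight-unfixed p β (n ∘ there))
      where
      flag : mark (up a β ≡ᵇ dn a γ) (Y a) ≈ mark (up a β ≡ᵇ dn a γ) (Y′ a)
      flag with a ℕ.≟ v
      ... | yes ≡.refl rewrite ≡ᵇ-false (λ e → n (here e)) = refl
      ... | no a≢v with up a β ≡ᵇ dn a γ
      ...   | true = p a a≢v
      ...   | false = refl

  weight-cong : ∀ {Y Y′} γ β → All (λ a → Y a ≈ Y′ a) β → weight Y γ β ≈ weight Y′ γ β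
  weight-cong γ [] [] = refl
  weight-cong γ (a ∷ β) (p ∷ ps) with up a β ≡ᵇ dn a γ
  ... | true = *-cong (*-congˡ p) (weight-cong (a ∷ γ) β ps)
  ... | false = *-congˡ (weight-cong (a ∷ γ) β ps)

  module _ (L : List ℕ) (uniq : Unique L) where

    total : (ℕ → Carrier) → ℕ → Carrier
    total Y n = Σₗ (tuples L n) (weight Y [])
    unfixed fixed : (ℕ → Carrier) → ℕ → ℕ → Carrier
    unfixed Y v n = Σₗ (filter (¬? ∘ hasFixed? v []) (tuples L n)) (weight Y [])
    fixed Y v n = Σₗ (filter (hasFixed? v []) (tuples L n)) (weight Y [])

    module _ {v} (v∈L : v ∈ L) where

      private
        insertion-∈ : ∀ n {β β′} → Insertion v [] β β′ → β ∈ tuples L n → β′ ∈ tuples L (suc n)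
        insertion-∈ n {β′ = β′} i β∈ with ≡.refl , β⊆ ← ∈-tuples⁻ n β∈ =
          ≡.subst (λ k → β′ ∈ tuples L k) (↭-length (insertion-↭ v i))
            (∈-tuples⁺ (All-resp-↭ (↭-sym (insertion-↭ v i)) (v∈L ∷ β⊆)))

        removal-∈ : ∀ n {β β′} → Insertion v [] β β′ → β′ ∈ tuples L (suc n) → β ∈ tuples L n
        removal-∈ n i β′∈ with l , β′⊆ ← ∈-tuples⁻ (suc n) β′∈ with All-resp-↭ (insertion-↭ v i) β′⊆
        ... | _ ∷ β⊆ = ≡.subst (λ k → _ ∈ tuples L k)
          (ℕₚ.suc-injective (≡.trans (≡.sym (↭-length (insertion-↭ v i))) l)) (∈-tuples⁺ β⊆)

        insertable : (β : List ℕ) → (isOdd v ≡ true → ¬ HasFixed v [] β) → ∃[ β′ ] Insertion v [] β β′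
        insertable β = insert v [] β z≤n

      fixed-even : isOdd v ≡ false → ∀ Y n → fixed Y v (suc n) ≈ x v * Y v * total Y n
      fixed-even e Y n = sym (trans (sym (Σₗ-* (tuples L n) _ _))
        (Σₗ-correspondence (Insertion v []) (tuples L n) _ (tuples-unique uniq n)
          (Unique.filter⁺ (hasFixed? v []) (tuples-unique uniq (suc n)))
          (λ {β} β∈ → let β′ , i = insertable β (λ o → ⊥-elim (false≢true (≡.trans (≡.sym e) o))) in
             β′ , ∈-filter⁺ (hasFixed? v []) (insertion-∈ n i β∈) (insertion⇒hasFixed v i) , i)
          (λ {β′} β′∈ → let β′∈′ , f = ∈-filter⁻ (hasFixed? v []) {xs = tuples L (suc n)} β′∈; β , i = remove v [] β′ f in
             β , removal-∈ n i β′∈′ , i)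
          (insertion-injective v) (insertion-functional v)
          (λ _ i → sym (weight-insertion v Y i))))
        where
        false≢true : false ≢ true
        false≢true ()

      fixed-odd : isOdd v ≡ true → ∀ Y n → fixed Y v (suc n) ≈ x v * Y v * unfixed Y v n
      fixed-odd o Y n = sym (trans (sym (Σₗ-* (filter (¬? ∘ hasFixed? v []) (tuples L n)) _ _))
        (Σₗ-correspondence (Insertion v []) _ _
          (Unique.filter⁺ (¬? ∘ hasFixed? v []) (tuples-unique uniq n))
          (Unique.filter⁺ (hasFixed? v []) (tuples-unique uniq (suc n)))
          (λ {β} β∈ → let β∈′ , ¬f = ∈-filter⁻ (¬? ∘ hasFixed? v []) {xs = tuples L n} β∈; β′ , i = insertable β (λ _ → ¬f) in
             β′ , ∈-filter⁺ (hasFixed? v []) (insertion-∈ n i β∈′) (insertion⇒hasFixed v i) , i)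
          (λ {β′} β′∈ → let β′∈′ , f = ∈-filter⁻ (hasFixed? v []) {xs = tuples L (suc n)} β′∈; β , i = remove v [] β′ f in
             β , ∈-filter⁺ (¬? ∘ hasFixed? v []) (removal-∈ n i β′∈′) (insertion-odd v o i) , i)
          (insertion-injective v) (insertion-functional v)
          (λ _ i → sym (weight-insertion v Y i))))

    total-split : ∀ Y v n → total Y n ≈ unfixed Y v n + fixed Y v n
    total-split Y v n = Σₗ-split (hasFixed? v []) (tuples L n) (weight Y [])

    unfixed-cong : ∀ {Y Y′} v → (∀ a → a ≢ v → Y a ≈ Y′ a) → ∀ n → unfixed Y v n ≈ unfixed Y′ v n
    unfixed-cong v p n = Σₗ-cong _ (λ {β} β∈ →
      weight-unfixed v p β (proj₂ (∈-filter⁻ (¬? ∘ hasFixed? v []) {xs = tuples L n} β∈)))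

-- From insertions to the quotient of products on the right-hand side

module Cancellation {c ℓ} (R : CommutativeRing c ℓ) where
  open CommutativeRing R
  open import Algebra.Solver.Ring.NaturalCoefficients.Default commutativeSemiring
    using (solve; _:*_; _:=_)
  open import Relation.Binary.Reasoning.Setoid setoid

  add-cancel : ∀ a b → (a + b) - b ≈ a
  add-cancel a b = trans (+-assoc _ _ _) (trans (+-congˡ (-‿inverseʳ b)) (+-identityʳ a))

  minus-neg : ∀ a b c → a - (- b) * c ≈ a + b * c
  minus-neg a b c = +-congˡ (trans (-‿cong (sym (-‿distribˡ-* b c))) (-‿involutive (b * c)))
    where open RingProperties (CommutativeRing.ring R)

  cancel-divisor : ∀ {P P⁻ A U F} → P * P⁻ ≈ 1# → P * A ≈ U → U * F * P⁻ ≈ F * A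
  cancel-divisor {P} {P⁻} {A} {U} {F} PP e = begin
    U * F * P⁻         ≈⟨ *-congʳ (*-congʳ e) ⟨
    P * A * F * P⁻     ≈⟨ solve 4 (λ p a f r → p :* a :* f :* r := f :* a :* (p :* r)) refl P A F P⁻ ⟩
    F * A * (P * P⁻)   ≈⟨ *-congˡ PP ⟩
    F * A * 1#         ≈⟨ *-identityʳ _ ⟩
    F * A              ∎

  -- `T₀` and `F⁻` are both inverse to F, hence equal. The rest turns a cross-multiplied identity
  -- back into a quotient.
  solve-quotient : ∀ {F F⁻ T T₀ A A⁻ B C C⁻ D} → F * F⁻ ≈ 1# → F * T₀ ≈ 1# →
    A * A⁻ ≈ 1# → C * C⁻ ≈ 1# → T * A * C ≈ T₀ * B * D → F⁻ * B * A⁻ * D * C⁻ ≈ T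
  solve-quotient {F} {F⁻} {T} {T₀} {A} {A⁻} {B} {C} {C⁻} {D} FF FT AA CC e = begin
    F⁻ * B * A⁻ * D * C⁻               ≈⟨ *-congʳ (*-congʳ (*-congʳ (*-congʳ F⁻≈T₀))) ⟩
    T₀ * B * A⁻ * D * C⁻               ≈⟨ solve 5 (λ t b a d c → t :* b :* a :* d :* c := t :* b :* d :*
        (a :* c)) refl T₀ B A⁻ D C⁻ ⟩
    T₀ * B * D * (A⁻ * C⁻)             ≈⟨ *-congʳ e ⟨
    T * A * C * (A⁻ * C⁻)              ≈⟨ solve 5 (λ t a c x y → t :* a :* c :* (x :* y) := t :*
        ((a :* x) :* (c :* y))) refl T A C A⁻ C⁻ ⟩
    T * ((A * A⁻) * (C * C⁻))          ≈⟨ *-congˡ (*-cong AA CC) ⟩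
    T * (1# * 1#)                      ≈⟨ trans (*-congˡ (*-identityˡ 1#)) (*-identityʳ T) ⟩
    T                                  ∎
    where
    F⁻≈T₀ : F⁻ ≈ T₀
    F⁻≈T₀ = begin
      F⁻             ≈⟨ *-identityˡ F⁻ ⟨
      1# * F⁻        ≈⟨ *-congʳ FT ⟨
      F * T₀ * F⁻    ≈⟨ solve 3 (λ f t g → f :* t :* g := t :* (f :* g)) refl F T₀ F⁻ ⟩
      T₀ * (F * F⁻)  ≈⟨ *-congˡ FF ⟩
      T₀ * 1#        ≈⟨ *-identityʳ T₀ ⟩
      T₀             ∎

  move-factor : ∀ {T T′ A C B D f g T₀} → f * T′ ≈ g * T → T * A * C ≈ T₀ * B * D →
    T′ * (A * f) * C ≈ T₀ * (B * g) * D
  move-factor {T} {T′} {A} {C} {B} {D} {f} {g} {T₀} p e = begin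
    T′ * (A * f) * C  ≈⟨ solve 4 (λ t a f c → t :* (a :* f) :* c := (f :* t) :* (a :* c)) refl T′ A f C ⟩
    (f * T′) * (A * C) ≈⟨ *-congʳ p ⟩
    (g * T) * (A * C)  ≈⟨ solve 4 (λ g t a c → (g :* t) :* (a :* c) := g :* (t :* a :* c)) refl g T A C ⟩
    g * (T * A * C)    ≈⟨ *-congˡ e ⟩
    g * (T₀ * B * D)   ≈⟨ solve 4 (λ g t b d → g :* (t :* b :* d) := t :* (b :* g) :* d) refl g T₀ B D ⟩
    T₀ * (B * g) * D  ∎

  move-factor′ : ∀ {T T′ A C B D f g T₀} → f * T′ ≈ g * T → T * A * C ≈ T₀ * B * D →
    T′ * A * (C * f) ≈ T₀ * B * (D * g)
  move-factor′ {T} {T′} {A} {C} {B} {D} {f} {g} {T₀} p e = begin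
    T′ * A * (C * f)  ≈⟨ solve 4 (λ t a f c → t :* a :* (c :* f) := (f :* t) :* (a :* c)) refl T′ A f C ⟩
    (f * T′) * (A * C) ≈⟨ *-congʳ p ⟩
    (g * T) * (A * C)  ≈⟨ solve 4 (λ g t a c → (g :* t) :* (a :* c) := g :* (t :* a :* c)) refl g T A C ⟩
    g * (T * A * C)    ≈⟨ *-congˡ e ⟩
    g * (T₀ * B * D)   ≈⟨ solve 4 (λ g t b d → g :* (t :* b :* d) := t :* b :* (d :* g)) refl g T₀ B D ⟩
    T₀ * B * (D * g)  ∎

module LinearFactors {c ℓ} (R : CommutativeRing c ℓ) where
  open CommutativeRing R
  open Series R
  open SeriesRing R using (seriesRing; ⊗≋∗)
  open FiniteSums R using (Σ≤-cong; Σ≤-*)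
  private
    R₁ = PowerSeries.commutativeRingˢ R
    module P₁ = PowerSeries R
    module P₂ = PowerSeries R₁
    module S = CommutativeRing seriesRing

  uOnly : (ℕ → Carrier) → Ser
  uOnly f i zero = f i
  uOnly f i (suc j) = 0#

  factor : Carrier → Ser
  factor k = one ⊖ scale k uVar

  scale-⊗ : ∀ k F G → (scale k F ⊗ G) ≋ scale k (F ⊗ G)
  scale-⊗ k F G i j = trans
    (Σ≤-cong i (λ a _ → trans (Σ≤-cong j (λ b _ → *-assoc _ _ _)) (Σ≤-* j k _))) (Σ≤-* i k _)

  uVar-⊗-zero : ∀ F j → (uVar ⊗ F) 0 j ≈ 0#
  uVar-⊗-zero F j = trans (⊗≋∗ uVar F 0 j) (P₁.zero-∗ (F 0) (λ _ → refl) j)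

  uVar-⊗-suc : ∀ F i j → (uVar ⊗ F) (suc i) j ≈ F i j
  uVar-⊗-suc F i j = trans (⊗≋∗ uVar F (suc i) j)
    (trans (+-cong (P₁.zero-∗ (F (suc i)) (λ _ → refl) j)
                   (P₂.∗-cong {P₂.tail uVar} {P₂.1ˢ} {F} {F} tail-uVar (λ _ _ → refl) i j))
      (trans (+-identityˡ _) (P₂.∗-identityˡ F i j)))
    where
    tail-uVar : P₂.tail uVar ≋ P₂.1ˢ
    tail-uVar zero zero = refl
    tail-uVar zero (suc j) = refl
    tail-uVar (suc i) j = refl

  factor-⊗ : ∀ k F i j → (factor k ⊗ F) i j ≈ F i j - k * (uVar ⊗ F) i j
  factor-⊗ k F i j = trans (S.distribʳ F one (S.- scale k uVar) i j)
    (+-cong (S.*-identityˡ F i j)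
      (trans (S.sym (-‿distribˡ-* (scale k uVar) F) i j) (-‿cong (scale-⊗ k uVar F i j))))
    where open RingProperties S.ring

  factor-uOnly : ∀ {k k′ f f′} → f′ 0 ≈ f 0 →
    (∀ n → f′ (suc n) - k′ * f′ n ≈ f (suc n) - k * f n) →
    (factor k′ ⊗ uOnly f′) ≋ (factor k ⊗ uOnly f)
  factor-uOnly {k} {k′} {f} {f′} p r i j =
    trans (factor-⊗ k′ (uOnly f′) i j) (trans (go i j) (sym (factor-⊗ k (uOnly f) i j)))
    where
    open RingProperties (CommutativeRing.ring R) using (-0#≈0#)
    go : ∀ i j → uOnly f′ i j - k′ * (uVar ⊗ uOnly f′) i j ≈ uOnly f i j - k * (uVar ⊗ uOnly f) i j
    vanish : ∀ {k x} → x ≈ 0# → - (k * x) ≈ 0#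
    vanish e = trans (-‿cong (trans (*-congˡ e) (zeroʳ _))) -0#≈0#
    go zero j = +-cong (start j)
      (trans (vanish (uVar-⊗-zero (uOnly f′) j)) (sym (vanish (uVar-⊗-zero (uOnly f) j))))
      where
      start : ∀ j → uOnly f′ 0 j ≈ uOnly f 0 j
      start zero = p
      start (suc j) = refl
    go (suc i) zero = trans (+-congˡ (-‿cong (*-congˡ (uVar-⊗-suc (uOnly f′) i 0))))
      (trans (r i) (+-congˡ (-‿cong (*-congˡ (sym (uVar-⊗-suc (uOnly f) i 0))))))
    go (suc i) (suc j) = +-congˡ
      (trans (vanish (uVar-⊗-suc (uOnly f′) i (suc j))) (sym (vanish (uVar-⊗-suc (uOnly f) i (suc j)))))

  geometric-uOnly : ∀ k f → f 0 ≈ 1# → (∀ n → f (suc n) ≈ k * f n) → (factor k ⊗ uOnly f) ≋ one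
  geometric-uOnly k f p r i j = trans (factor-⊗ k (uOnly f) i j) (go i j)
    where
    open RingProperties (CommutativeRing.ring R) using (-0#≈0#)
    vanish : ∀ {x} → x ≈ 0# → - (k * x) ≈ 0#
    vanish e = trans (-‿cong (trans (*-congˡ e) (zeroʳ _))) -0#≈0#
    go : ∀ i j → uOnly f i j - k * (uVar ⊗ uOnly f) i j ≈ one i j
    go zero zero = trans (+-cong p (vanish (uVar-⊗-zero (uOnly f) 0))) (+-identityʳ _)
    go zero (suc j) = trans (+-congˡ (vanish (uVar-⊗-zero (uOnly f) (suc j)))) (+-identityʳ _)
    go (suc i) zero = trans (+-cong (r i) (-‿cong (*-congˡ (uVar-⊗-suc (uOnly f) i 0)))) (-‿inverseʳ _)
    go (suc i) (suc j) = trans (+-congˡ (vanish (uVar-⊗-suc (uOnly f) i (suc j)))) (+-identityʳ _)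

half-even : ∀ k → (k ℕ.+ k) ℕ./ 2 ≡ k
half-even zero = ≡.refl
half-even (suc k) = ≡.trans (≡.cong (λ m → suc m ℕ./ 2) (ℕₚ.+-suc k k))
  (≡.trans (DivMod.m/n≡1+[m∸n]/n (s≤s (s≤s (z≤n {k ℕ.+ k})))) (≡.cong suc (half-even k)))

half-odd : ∀ k → suc (k ℕ.+ k) ℕ./ 2 ≡ k
half-odd zero = ≡.refl
half-odd (suc k) = ≡.trans (≡.cong (λ m → suc (suc m) ℕ./ 2) (ℕₚ.+-suc k k))
  (≡.trans (DivMod.m/n≡1+[m∸n]/n (s≤s (s≤s (z≤n {suc (k ℕ.+ k)})))) (≡.cong suc (half-odd k)))

isOdd-double : ∀ k → isOdd (k ℕ.+ k) ≡ false
isOdd-double zero = ≡.refl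
isOdd-double (suc k) rewrite ℕₚ.+-suc k k | isOdd-double k = ≡.refl

parity : ∀ n → ∃[ k ] (n ≡ k ℕ.+ k ⊎ n ≡ suc (k ℕ.+ k))
parity zero = 0 , inj₁ ≡.refl
parity (suc n) with parity n
... | k , inj₁ e = k , inj₂ (≡.cong suc e)
... | k , inj₂ e = suc k , inj₁ (≡.cong suc (≡.trans e (≡.sym (ℕₚ.+-suc k k))))

module RightSide {c ℓ} (R : CommutativeRing c ℓ) (q Y₀ Y₁ Z : CommutativeRing.Carrier R) where
  open CommutativeRing R
  open Series R
  open SeriesRing R using (seriesRing; inv-correct; ⊗-cong)
  open LinearFactors R
  open Cancellation R using (add-cancel; minus-neg)
  open ListSums R
  open import Algebra.Solver.Ring.NaturalCoefficients.Default commutativeSemiring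
    using (solve; _:+_; _:*_; _:=_)
  open RingProperties ring using (-‿distribʳ-*)
  private
    module S = CommutativeRing seriesRing
    module SC = Cancellation seriesRing

  x : ℕ → Carrier
  x v = pow q v * Zodd Z v

  Y : ℕ → Carrier
  Y v = if isOdd v then Y₁ else Y₀

  open FixedPointWeights R x

  letters≤ : ℕ → List ℕ
  letters≤ s = downFrom (suc s)

  wordSum : (ℕ → Carrier) → ℕ → ℕ → Carrier
  wordSum W s = total (letters≤ s) (Unique.downFrom⁺ (suc s)) W

  -- Interpolates between the trivial weight at v = 0 and, on the letters 0,...,s, the weight `Y` at
  -- v = s + 1.
  cutoff : ℕ → ℕ → Carrier
  cutoff v a = if a <ᵇ v then Y a else 1#

  cutoff-other : ∀ v a → a ≢ v → cutoff (suc v) a ≈ cutoff v a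
  cutoff-other v a a≢v with ℕₚ.<-cmp a v
  ... | tri≈ _ a≡v _ = ⊥-elim (a≢v a≡v)
  ... | tri< a<v _ _ rewrite T⇒≡true (ℕₚ.<⇒<ᵇ a<v) | T⇒≡true (ℕₚ.<⇒<ᵇ (ℕₚ.m<n⇒m<1+n a<v)) = refl
  ... | tri> _ _ v<a rewrite ¬T⇒≡false (ℕₚ.<-asym v<a ∘ ℕₚ.<ᵇ⇒< a v)
                           | ¬T⇒≡false (ℕₚ.<⇒≱ v<a ∘ ℕₚ.≤-pred ∘ ℕₚ.<ᵇ⇒< a (suc v)) = refl

  cutoff-at : ∀ v → cutoff (suc v) v ≡ Y v
  cutoff-at v rewrite T⇒≡true (ℕₚ.<⇒<ᵇ (ℕₚ.n<1+n v)) = ≡.refl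

  cutoff-below : ∀ v → cutoff v v ≡ 1#
  cutoff-below v rewrite ¬T⇒≡false (ℕₚ.<-irrefl ≡.refl ∘ ℕₚ.<ᵇ⇒< v v) = ≡.refl

  stage : ℕ → ℕ → Ser
  stage s v = uOnly (wordSum (cutoff v) s)

  module _ (s v : ℕ) (v≤s : v ≤ s) where
    private
      L = letters≤ s
      uL = Unique.downFrom⁺ (suc s)
      v∈L = ∈-downFrom⁺ (s≤s v≤s)
      -- The weight of a word without a fixed v does not involve the value at v, so N and N′ agree.
      -- This common series links the two stages.
      N N′ F F′ : ℕ → Carrier
      N = unfixed L uL (cutoff v) v
      N′ = unfixed L uL (cutoff (suc v)) v
      F = wordSum (cutoff v) s
      F′ = wordSum (cutoff (suc v)) s
      N′≈N : ∀ n → N′ n ≈ N n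
      N′≈N = unfixed-cong L uL v (cutoff-other v)
      F₀ : F′ 0 ≈ F 0
      F₀ = refl
      empty : ∀ Y → wordSum Y s 0 ≈ unfixed L uL Y v 0
      empty Y = trans (total-split L uL Y v 0) (+-identityʳ _)

    -- As generating functions in u, `fixed-even` gives F = N + u x_v F and F′ = N + u x_v Y₀ F′, so
    -- both sides equal N.
    stage-even : isOdd v ≡ false → (factor (x v * Y₀) ⊗ stage s (suc v)) ≋ (factor (x v) ⊗ stage s v)
    stage-even e = factor-uOnly F₀ (λ n → trans (coefficient′ n) (sym (coefficient n)))
      where
      Yv : cutoff (suc v) v ≡ Y₀
      Yv = ≡.trans (cutoff-at v) (≡.cong (if_then Y₁ else Y₀) e)
      coefficient′ : ∀ n → F′ (suc n) - x v * Y₀ * F′ n ≈ N (suc n)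
      coefficient′ n = trans (+-congʳ (trans (total-split L uL (cutoff (suc v)) v (suc n))
        (+-cong (N′≈N (suc n)) (trans (fixed-even L uL v∈L e (cutoff (suc v)) n)
          (*-congʳ (*-congˡ (reflexive Yv))))))) (add-cancel _ _)
      coefficient : ∀ n → F (suc n) - x v * F n ≈ N (suc n)
      coefficient n = trans (+-congʳ (trans (total-split L uL (cutoff v) v (suc n))
        (+-congˡ (trans (fixed-even L uL v∈L e (cutoff v) n)
          (*-congʳ (trans (*-congˡ (reflexive (cutoff-below v))) (*-identityʳ _))))))) (add-cancel _ _)

    -- By `fixed-odd`, F = (1 + u x_v) N and F′ = (1 + u x_v Y₁) N. Both sides are (1 + u x_v)(1 + u
    -- x_v Y₁) N.
    stage-odd : isOdd v ≡ true → (factor (- x v) ⊗ stage s (suc v)) ≋ (factor (- (x v * Y₁)) ⊗ stage s v)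
    stage-odd o = factor-uOnly F₀ (λ n → trans (minus-neg _ _ _)
      (trans (coefficients n) (sym (minus-neg _ _ _))))
      where
      Yv : cutoff (suc v) v ≡ Y₁
      Yv = ≡.trans (cutoff-at v) (≡.cong (if_then Y₁ else Y₀) o)
      F′-suc : ∀ n → F′ (suc n) ≈ N (suc n) + x v * Y₁ * N n
      F′-suc n = trans (total-split L uL (cutoff (suc v)) v (suc n))
        (+-cong (N′≈N (suc n)) (trans (fixed-odd L uL v∈L o (cutoff (suc v)) n)
          (*-cong (*-congˡ (reflexive Yv)) (N′≈N n))))
      F-suc : ∀ n → F (suc n) ≈ N (suc n) + x v * N n
      F-suc n = trans (total-split L uL (cutoff v) v (suc n))
        (+-congˡ (trans (fixed-odd L uL v∈L o (cutoff v) n)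
          (*-congʳ (trans (*-congˡ (reflexive (cutoff-below v))) (*-identityʳ _)))))
      coefficients : ∀ n → F′ (suc n) + x v * F′ n ≈ F (suc n) + x v * Y₁ * F n
      coefficients zero = trans (+-cong (F′-suc 0) (*-congˡ (trans F₀ (empty (cutoff v)))))
        (trans (solve 4 (λ a b x y → (a :+ x :* y :* b) :+ x :* b := (a :+ x :* b) :+ x :* y :* b) refl
                 (N 1) (N 0) (x v) Y₁)
          (sym (+-cong (F-suc 0) (*-congˡ (empty (cutoff v))))))
      coefficients (suc n) = trans (+-cong (F′-suc (suc n)) (*-congˡ (F′-suc n)))
        (trans (solve 5 (λ a b c x y → (a :+ x :* y :* b) :+ x :* (b :+ x :* y :* c) :=
                                       (a :+ x :* b) :+ x :* y :* (b :+ x :* c)) refl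
                 (N (suc (suc n))) (N (suc n)) (N n) (x v) Y₁)
          (sym (+-cong (F-suc (suc n)) (*-congˡ (F-suc n)))))

  q² : Carrier
  q² = q * q

  pow-double : ∀ k → pow q² k ≈ pow q (k ℕ.+ k)
  pow-double zero = refl
  pow-double (suc k) rewrite ℕₚ.+-suc k k = trans (*-congˡ (pow-double k)) (*-assoc _ _ _)

  x-even : ∀ k → x (k ℕ.+ k) ≈ pow q² k
  x-even k rewrite isOdd-double k = trans (*-identityʳ _) (sym (pow-double k))

  x-odd : ∀ k → x (suc (k ℕ.+ k)) ≈ pow q² k * (q * Z)
  x-odd k rewrite isOdd-double k = trans (*-congʳ (*-congˡ (sym (pow-double k))))
    (solve 3 (λ p q z → q :* p :* z := p :* (q :* z)) refl _ _ _)

  factor-cong : ∀ {k k′} → k ≈ k′ → factor k ≋ factor k′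
  factor-cong e i j = +-congˡ (-‿cong (*-congʳ e))

  factor-scale : ∀ a k → (one ⊖ scale a (scale k uVar)) ≋ factor (a * k)
  factor-scale a k i j = +-congˡ (-‿cong (sym (*-assoc _ _ _)))

  A B C D : ℕ → Ser
  A = poch (scale Y₀ uVar) q²
  B = poch uVar q²
  C = poch (scale (- (q * Z)) uVar) q²
  D = poch (scale (- (q * Y₁ * Z)) uVar) q²

  -- The product formula after the values 0,...,v-1, cleared of denominators; k and l are meant to
  -- be the numbers of even and odd values among these.
  StageProduct : ℕ → ℕ → ℕ → ℕ → Set ℓ
  StageProduct s v k l = (stage s v ⊗ A k ⊗ C l) ≋ (stage s 0 ⊗ B k ⊗ D l)

  even-step : ∀ s k → k ℕ.+ k ≤ s → StageProduct s (k ℕ.+ k) k k → StageProduct s (suc (k ℕ.+ k)) (suc k) k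
  even-step s k p = SC.move-factor {stage s v} {stage s (suc v)} {A k} {C k} {B k} {D k} {fA} {fB} {stage s 0}
    (S.trans {fA ⊗ stage s (suc v)}
      (⊗-cong {fA} {H = stage s (suc v)} (S.trans (factor-scale (pow q² k) Y₀)
          (factor-cong (*-congʳ (sym (x-even k))))) S.refl)
      (S.trans {factor (x v * Y₀) ⊗ stage s (suc v)} (stage-even s v p (isOdd-double k))
        (⊗-cong {factor (x v)} {fB} {stage s v} (factor-cong (x-even k)) S.refl)))
    where
    v = k ℕ.+ k
    fA = one ⊖ scale (pow q² k) (scale Y₀ uVar)
    fB = factor (pow q² k)

  odd-step : ∀ s k → suc (k ℕ.+ k) ≤ s → StageProduct s (suc (k ℕ.+ k)) (suc k) k →
             StageProduct s (suc (suc (k ℕ.+ k))) (suc k) (suc k)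
  odd-step s k p = SC.move-factor′ {stage s v} {stage s (suc v)} {A (suc k)} {C k} {B (suc k)} {D k}
      {fC} {fD} {stage s 0}
    (S.trans {fC ⊗ stage s (suc v)}
      (⊗-cong {fC} {H = stage s (suc v)} (S.trans (factor-scale (pow q² k) (- (q * Z))) (factor-cong
        (trans (sym (-‿distribʳ-* _ _)) (-‿cong (sym (x-odd k)))))) S.refl)
      (S.trans {factor (- x v) ⊗ stage s (suc v)} (stage-odd s v p (≡.cong not (isOdd-double k)))
        (⊗-cong {factor (- (x v * Y₁))} {fD} {stage s v}
            (S.sym {fD} (S.trans (factor-scale (pow q² k) (- (q * Y₁ * Z))) (factor-cong
          (trans (sym (-‿distribʳ-* _ _)) (-‿cong (trans
            (solve 4 (λ p q y z → p :* (q :* y :* z) := p :* (q :* z) :* y) refl _ _ _ _)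
            (*-congʳ (sym (x-odd k))))))))) S.refl)))
    where
    v = suc (k ℕ.+ k)
    fC = one ⊖ scale (pow q² k) (scale (- (q * Z)) uVar)
    fD = one ⊖ scale (pow q² k) (scale (- (q * Y₁ * Z)) uVar)

  stages-even : ∀ s k → k ℕ.+ k ≤ suc s → StageProduct s (k ℕ.+ k) k k
  stages-even s zero p = S.refl
  stages-even s (suc k) p = ≡.subst (λ v → StageProduct s (suc v) (suc k) (suc k)) (≡.sym (ℕₚ.+-suc k k))
    (odd-step s k p′ (even-step s k (ℕₚ.<⇒≤ p′) (stages-even s k (ℕₚ.m≤n⇒m≤1+n (ℕₚ.<⇒≤ p′)))))
    where
    p′ : suc (k ℕ.+ k) ≤ s
    p′ = ≡.subst (_≤ s) (ℕₚ.+-suc k k) (ℕₚ.≤-pred p)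

  -- Among 0,...,s there are ⌊s/2⌋ + 1 even and ⌊(s+1)/2⌋ odd values, which explains the lengths of
  -- the Pochhammer products.
  stages : ∀ s → StageProduct s (suc s) (suc (s ℕ./ 2)) (suc s ℕ./ 2)
  stages s with parity s
  ... | k , inj₁ ≡.refl rewrite half-even k | half-odd k =
    even-step _ k ℕₚ.≤-refl (stages-even _ k (ℕₚ.n≤1+n _))
  ... | k , inj₂ ≡.refl rewrite half-odd k = ≡.subst (StageProduct s (suc (suc (k ℕ.+ k))) (suc k))
    (≡.sym (≡.trans (DivMod.m/n≡1+[m∸n]/n (s≤s (s≤s (z≤n {k ℕ.+ k})))) (≡.cong suc (half-even k))))
    (≡.subst (λ v → StageProduct s v (suc k) (suc k)) (≡.cong suc (ℕₚ.+-suc k k))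
        (stages-even s (suc k) (s≤s (ℕₚ.≤-reflexive (ℕₚ.+-suc k k)))))

  -- With trivial marks the letters contribute independently, so the generating function of all
  -- words is geometric.
  words-power : ∀ s n → wordSum (cutoff 0) s (suc n) ≈ cs q Z s * wordSum (cutoff 0) s n
  words-power s n = trans (Σₗ-tuples (letters≤ s) n _)
    (trans (Σₗ-cong (letters≤ s) (λ {a} _ → trans (Σₗ-cong (tuples (letters≤ s) n) (λ {ws} _ →
        *-cong (trans (*-congˡ (mark-1 (up a ws ≡ᵇ 0))) (*-identityʳ (x a))) (prefix-irrelevant ws)))
        (trans (Σₗ-* (tuples (letters≤ s) n) (x a) _) (*-comm _ _))))
      (trans (Σₗ-* (letters≤ s) _ x) (trans (*-comm _ _) (*-congʳ (Σₗ-downFrom s x)))))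
    where
    mark-1 : ∀ b → mark b 1# ≈ 1#
    mark-1 true = refl
    mark-1 false = refl
    prefix-irrelevant : ∀ {γ δ} β → weight (cutoff 0) γ β ≈ weight (cutoff 0) δ β
    prefix-irrelevant [] = refl
    prefix-irrelevant {γ} {δ} (a ∷ β) = *-cong
      (*-congˡ (trans (mark-1 (up a β ≡ᵇ dn a γ)) (sym (mark-1 (up a β ≡ᵇ dn a δ))))) (prefix-irrelevant β)

  stage-last : ∀ s → stage s (suc s) ≋ uOnly (wordSum Y s)
  stage-last s i zero = Σₗ-cong (tuples (letters≤ s) i) (λ {w} w∈ →
    weight-cong [] w (All.map (λ a∈ → same-Y (∈-downFrom⁻ a∈)) (proj₂ (∈-tuples⁻ i w∈))))
    where
    same-Y : ∀ {a} → a < suc s → cutoff (suc s) a ≈ Y a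
    same-Y {a} a<s rewrite T⇒≡true (ℕₚ.<⇒<ᵇ a<s) = refl
  stage-last s i (suc j) = refl

  poch-unit : ∀ k n → poch (scale k uVar) q² n 0 0 ≈ 1#
  poch-unit k zero = refl
  poch-unit k (suc n) = trans (*-cong (poch-unit k n)
    (trans (+-congˡ (trans (-‿cong (trans (*-congˡ (zeroʳ k)) (zeroʳ _))) -0#≈0#)) (+-identityʳ 1#)))
        (*-identityʳ 1#)
    where open RingProperties ring using (-0#≈0#)

  rhsTerm : ℕ → Ser
  rhsTerm s = inv (one ⊖ scale (cs q Z s) uVar)
    ⊗ poch uVar q² (suc (s ℕ./ 2))
    ⊗ inv (poch (scale Y₀ uVar) q² (suc (s ℕ./ 2)))
    ⊗ poch (scale (- (q * Y₁ * Z)) uVar) q² (suc s ℕ./ 2)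
    ⊗ inv (poch (scale (- (q * Z)) uVar) q² (suc s ℕ./ 2))

  term-words : ∀ s → rhsTerm s ≋ uOnly (wordSum Y s)
  term-words s = S.trans {inv (factor (cs q Z s)) ⊗ B k ⊗ inv (A k) ⊗ D l ⊗ inv (C l)}
    (SC.solve-quotient {factor (cs q Z s)} {inv (factor (cs q Z s))} {stage s (suc s)} {stage s 0}
      {A k} {inv (A k)} {B k} {C l} {inv (C l)} {D l}
      (inv-correct (factor (cs q Z s)) (trans (+-congˡ (trans (-‿cong (zeroʳ _)) -0#≈0#)) (+-identityʳ 1#)))
      (geometric-uOnly (cs q Z s) (wordSum (cutoff 0) s) (+-identityʳ 1#) (words-power s))
      (inv-correct (A k) (poch-unit Y₀ k)) (inv-correct (C l) (poch-unit (- (q * Z)) l)) (stages s))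
    (stage-last s)
    where
    open RingProperties ring using (-0#≈0#)
    k = suc (s ℕ./ 2)
    l = suc s ℕ./ 2

  -- The factors multiplying t^s are free of t, so t^s picks out a single term.
  RHS-words : ∀ n s → RHS q Y₀ Y₁ Z n s ≈ wordSum Y s n
  RHS-words n s = trans (FiniteSums.Σ≤-last R s (λ r r<s → positive r (ℕₚ.m<n⇒0<n∸m r<s)))
    (trans (reflexive (≡.cong (rhsTerm s n) (ℕₚ.n∸n≡0 s))) (term-words s n 0))
    where
    positive : ∀ r {j} → 0 < j → rhsTerm r n j ≈ 0#
    positive r {suc j} _ = term-words r n (suc j)

-- Sorting labelled letters: words as pairs of a signed permutation and a compatible word

module StrictSorting {a r} {A : Set a} {_≺_ : A → A → Set r} (≺-trans : Transitive _≺_)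
    (≺-asym : Asymmetric _≺_) where

  sorted-unique : ∀ {xs ys} → AllPairs _≺_ xs → AllPairs _≺_ ys → xs ↭ ys → xs ≡ ys
  sorted-unique {[]} s s′ p = ≡.sym (↭-empty-inv (↭-sym p))
  sorted-unique {x ∷ xs} {[]} s s′ p with () ← ↭-length p
  sorted-unique {x ∷ xs} {y ∷ ys} (x≺ ∷ s) (y≺ ∷ s′) p
    with ∈-resp-↭ p (here ≡.refl) | ∈-resp-↭ (↭-sym p) (here ≡.refl)
  ... | here ≡.refl | _ = ≡.cong (x ∷_) (sorted-unique s s′ (drop-∷ p))
  ... | there _ | here ≡.refl = ≡.cong (x ∷_) (sorted-unique s s′ (drop-∷ p))
  ... | there x∈ys | there y∈xs = ⊥-elim (≺-asym (All.lookup x≺ y∈xs) (All.lookup y≺ x∈ys))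

  sorted-insert : ∀ {x} xs → All (λ y → x ≺ y ⊎ y ≺ x) xs → AllPairs _≺_ xs →
                  ∃[ ys ] AllPairs _≺_ ys × ys ↭ x ∷ xs
  sorted-insert {x} [] _ _ = x ∷ [] , [] ∷ [] , ↭-refl
  sorted-insert {x} (y ∷ xs) (inj₁ x≺y ∷ _) (y≺ ∷ s) =
    x ∷ y ∷ xs , (x≺y ∷ All.map (≺-trans x≺y) y≺) ∷ y≺ ∷ s , ↭-refl
  sorted-insert {x} (y ∷ xs) (inj₂ y≺x ∷ c) (y≺ ∷ s) with ys , s′ , p ← sorted-insert xs c s =
    y ∷ ys , All-resp-↭ (↭-sym p) (y≺x ∷ y≺) ∷ s′ , ↭-trans (↭-prep y p) (↭-swap y x ↭-refl)

  sorting : ∀ xs → AllPairs (λ x y → x ≺ y ⊎ y ≺ x) xs → ∃[ ys ] AllPairs _≺_ ys × ys ↭ xs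
  sorting [] _ = [] , [] , ↭-refl
  sorting (x ∷ xs) (c ∷ cs) with ys , s , p ← sorting xs cs
    with zs , s′ , p′ ← sorted-insert ys (All-resp-↭ (↭-sym p) c) s = zs , s′ , ↭-trans p′ (↭-prep x p)

-- (x , v) stands for the letter v at position ∣ x ∣ of a word, where x is negative iff v is odd.
Labelled : Set
Labelled = ℤ × ℕ

-- As odd letters carry negated positions, one comparison of integers yields both reading orders of
-- equal letters. It also makes a descent of signed positions force a strict drop of the letters.
_≺_ : Labelled → Labelled → Set
(x , v) ≺ (y , u) = u < v ⊎ (v ≡ u × x ℤ.< y)

_≺?_ : ∀ p r → Dec (p ≺ r)
(x , v) ≺? (y , u) = (u ℕ.<? v) ⊎-dec ((v ℕ.≟ u) ×-dec (x ℤ.<? y))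

≺-trans : Transitive _≺_
≺-trans (inj₁ p) (inj₁ r) = inj₁ (ℕₚ.<-trans r p)
≺-trans (inj₁ p) (inj₂ (≡.refl , _)) = inj₁ p
≺-trans (inj₂ (≡.refl , _)) (inj₁ r) = inj₁ r
≺-trans (inj₂ (≡.refl , p)) (inj₂ (≡.refl , r)) = inj₂ (≡.refl , ℤₚ.<-trans p r)

≺-asym : Asymmetric _≺_
≺-asym (inj₁ p) (inj₁ r) = ℕₚ.<-asym p r
≺-asym (inj₁ p) (inj₂ (≡.refl , _)) = ℕₚ.<-irrefl ≡.refl p
≺-asym (inj₂ (≡.refl , _)) (inj₁ r) = ℕₚ.<-irrefl ≡.refl r
≺-asym (inj₂ (≡.refl , p)) (inj₂ (_ , r)) = ℤₚ.<-asym p r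

≺-irrefl : ∀ p → ¬ (p ≺ p)
≺-irrefl p l = ≺-asym {p} {p} l l

≺-comparable : ∀ {p r} → proj₁ p ≢ proj₁ r → p ≺ r ⊎ r ≺ p
≺-comparable {x , v} {y , u} x≢y with ℕₚ.<-cmp v u | ℤₚ.<-cmp x y
... | tri< v<u _ _ | _ = inj₂ (inj₁ v<u)
... | tri> _ _ u<v | _ = inj₁ (inj₁ u<v)
... | tri≈ _ v≡u _ | tri< x<y _ _ = inj₁ (inj₂ (v≡u , x<y))
... | tri≈ _ v≡u _ | tri≈ _ x≡y _ = ⊥-elim (x≢y x≡y)
... | tri≈ _ v≡u _ | tri> _ _ y<x = inj₂ (inj₂ (≡.sym v≡u , y<x))

open StrictSorting {_≺_ = _≺_} (λ {p} {r} {t} → ≺-trans {p} {r} {t}) (λ {p} {r} → ≺-asym {p} {r})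

signed : ℕ → ℕ → ℤ
signed j a = if isOdd a then ℤ.- (+ j) else + j

label : ℕ → List ℕ → List Labelled
label j [] = []
label j (a ∷ c) = (signed j a , a) ∷ label (suc j) c

range : ℕ → ℕ → List ℕ
range j zero = []
range j (suc n) = j ∷ range (suc j) n

∣signed∣ : ∀ j a → ∣ signed j a ∣ ≡ j
∣signed∣ j a with isOdd a
... | true = ℤₚ.∣-i∣≡∣i∣ (+ j)
... | false = ≡.refl

SignMatches : Labelled → Set
SignMatches (x , v) = isNeg x ≡ isOdd v

signed-matches : ∀ j a → SignMatches (signed (suc j) a , a)
signed-matches j a with isOdd a
... | true = ≡.refl
... | false = ≡.refl

matches⇒signed : ∀ x v → SignMatches (x , v) → x ≡ signed ∣ x ∣ v
matches⇒signed (+ n) v e rewrite ≡.sym e = ≡.refl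
matches⇒signed -[1+ n ] v e rewrite ≡.sym e = ≡.refl

absolute : Labelled → ℕ
absolute p = ∣ proj₁ p ∣

absolute-label : ∀ j c → map absolute (label j c) ≡ range j (length c)
absolute-label j [] = ≡.refl
absolute-label j (a ∷ c) = ≡.cong₂ _∷_ (∣signed∣ j a) (absolute-label (suc j) c)

letters-label : ∀ j c → map proj₂ (label j c) ≡ c
letters-label j [] = ≡.refl
letters-label j (a ∷ c) = ≡.cong (a ∷_) (letters-label (suc j) c)

matches-label : ∀ j c → All SignMatches (label (suc j) c)
matches-label j [] = []
matches-label j (a ∷ c) = signed-matches j a ∷ matches-label (suc j) c

label-≥ : ∀ j c → All (λ p → j ≤ absolute p) (label j c)
label-≥ j [] = []
label-≥ j (a ∷ c) = ℕₚ.≤-reflexive (≡.sym (∣signed∣ j a)) ∷ All.map ℕₚ.<⇒≤ (label-≥ (suc j) c)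

-- Only the head of a labelling has absolute position j, so the heads agree and can be removed.
label-injective : ∀ j {c c′} → label j c ↭ label j c′ → c ≡ c′
label-injective j {[]} {[]} p = ≡.refl
label-injective j {[]} {_ ∷ _} p with () ← ↭-length p
label-injective j {_ ∷ _} {[]} p with () ← ↭-length p
label-injective j {a ∷ c} {a′ ∷ c′} p with ∈-resp-↭ p (here ≡.refl)
... | here e with ≡.refl ← ≡.cong proj₂ e = ≡.cong (a ∷_) (label-injective (suc j) (drop-∷ p))
... | there i = ⊥-elim (ℕₚ.<-irrefl (≡.sym (∣signed∣ j a)) (All.lookup (label-≥ (suc j) c′) i))

-- The positions tell in which order to read the letters, and the signs are then the ones that
-- `label` would give.
labelling : ∀ j n P → map absolute P ↭ range j n → All SignMatches P → ∃[ c ] label j c ↭ P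
labelling j zero [] p m = [] , ↭-refl
labelling j zero (_ ∷ _) p m with () ← ↭-length p
labelling j (suc n) P p m with ∈-map⁻ absolute (∈-resp-↭ (↭-sym p) (here ≡.refl))
... | (x , v) , p∈P , ≡.refl with P′ , e ← ∈⇒↭∷ p∈P with mx ∷ m′ ← All-resp-↭ e m
  with c , l ← labelling (suc j) n P′ (drop-∷ (↭-trans (↭-sym (map⁺ absolute e)) p)) m′ =
  v ∷ c , ↭-trans (≡.subst (λ y → (y , v) ∷ label (suc j) c ↭ (x , v) ∷ P′) (matches⇒signed x v mx)
      (↭-prep (x , v) l)) (↭-sym e)

range-unique : ∀ j n → Unique (range j n)
range-unique j n = go j n
  where
  all-≥ : ∀ j n → All (j ≤_) (range j n)
  all-≥ j zero = []
  all-≥ j (suc n) = ℕₚ.≤-refl ∷ All.map ℕₚ.<⇒≤ (all-≥ (suc j) n)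
  go : ∀ j n → Unique (range j n)
  go j zero = []
  go j (suc n) = All.map ℕₚ.<⇒≢ (all-≥ (suc j) n) ∷ go (suc j) n

∈-range⁺ : ∀ j n {k} → k < n → (j ℕ.+ k) ∈ range j n
∈-range⁺ j (suc n) {zero} _ = here (ℕₚ.+-identityʳ j)
∈-range⁺ j (suc n) {suc k} (s≤s k<n) = there (≡.subst (_∈ range (suc j) n) (≡.sym (ℕₚ.+-suc j k))
    (∈-range⁺ (suc j) n k<n))

∈-range⁻ : ∀ j n {i} → i ∈ range j n → ∃[ k ] k < n × i ≡ j ℕ.+ k
∈-range⁻ j (suc n) (here e) = 0 , s≤s z≤n , ≡.trans e (≡.sym (ℕₚ.+-identityʳ j))
∈-range⁻ j (suc n) (there i) with k , l , e ← ∈-range⁻ (suc j) n i = suc k , s≤s l , ≡.trans e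
    (≡.sym (ℕₚ.+-suc j k))

length-range : ∀ j n → length (range j n) ≡ n
length-range j zero = ≡.refl
length-range j (suc n) = ≡.cong suc (length-range (suc j) n)

words≡tuples : ∀ n k → words n k ≡ tuples (letters n) k
words≡tuples n zero = ≡.refl
words≡tuples n (suc k) = ≡.trans (concatMap-map _∷_ (letters n) (words n k))
  (≡.cong (cartesianProductWith _∷_ (letters n)) (words≡tuples n k))

letters-unique : ∀ n → Unique (letters n)
letters-unique n = Unique.++⁺
  (Unique.map⁺ (λ { ≡.refl → ≡.refl }) (Unique.upTo⁺ n))
  (Unique.map⁺ (λ { ≡.refl → ≡.refl }) (Unique.upTo⁺ n))
  (λ (p , r) → disjoint (∈-map⁻ _ p) (∈-map⁻ _ r))
  where
  disjoint : ∀ {x} {P Q : ℕ → Set} → ∃[ k ] P k × x ≡ + suc k → ¬ (∃[ k ] Q k × x ≡ ℤ.- (+ suc k))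
  disjoint (_ , _ , ≡.refl) (_ , _ , ())

∈-letters⁺ : ∀ n {k} a → k < n → signed (suc k) a ∈ letters n
∈-letters⁺ n a k<n with isOdd a
... | true = ∈-++⁺ʳ _ (∈-map⁺ _ (∈-upTo⁺ k<n))
... | false = ∈-++⁺ˡ (∈-map⁺ _ (∈-upTo⁺ k<n))

∈-letters⁻ : ∀ n {x} → x ∈ letters n → ∣ x ∣ ∈ range 1 n
∈-letters⁻ n x∈ with ∈-++⁻ (map (λ k → + suc k) (upTo n)) x∈
... | inj₁ i with k , k∈ , ≡.refl ← ∈-map⁻ (λ k → + suc k) i = ∈-range⁺ 1 n (∈-upTo⁻ k∈)
... | inj₂ i with k , k∈ , ≡.refl ← ∈-map⁻ (λ k → ℤ.- (+ suc k)) i = ∈-range⁺ 1 n (∈-upTo⁻ k∈)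

unique-abs? : (w : List ℤ) → Dec (Unique (map ∣_∣ w))
unique-abs? w = UniqueDec.unique? ℕ._≟_ (map ∣_∣ w)

SignedPerms-unique : ∀ n → Unique (SignedPerms n)
SignedPerms-unique n = Unique.filter⁺ unique-abs?
  (≡.subst Unique (≡.sym (words≡tuples n n)) (tuples-unique (letters-unique n) n))

∈-SignedPerms⁺ : ∀ {n} P → map absolute P ↭ range 1 n → All SignMatches P → map proj₁ P ∈ SignedPerms n
∈-SignedPerms⁺ {n} P p m = ∈-filter⁺ unique-abs?
  (≡.subst (map proj₁ P ∈_) (≡.sym (words≡tuples n n))
    (≡.subst (λ k → map proj₁ P ∈ tuples (letters n) k) len (∈-tuples⁺ (Allₚ.map⁺ (All.tabulate member)))))
  (≡.subst Unique (Listₚ.map-∘ P) (Unique-resp-↭ (↭-sym p) (range-unique 1 n)))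
  where
  len : length (map proj₁ P) ≡ n
  len = ≡.trans (Listₚ.length-map proj₁ P) (≡.trans (≡.sym (Listₚ.length-map absolute P))
    (≡.trans (↭-length p) (length-range 1 n)))
  member : ∀ {r} → r ∈ P → proj₁ r ∈ letters n
  member {x , v} r∈P with k , k<n , e ← ∈-range⁻ 1 n (∈-resp-↭ p (∈-map⁺ absolute r∈P)) =
    ≡.subst (_∈ letters n) (≡.sym (≡.trans (matches⇒signed x v (All.lookup m r∈P))
        (≡.cong (λ i → signed i v) e)))
      (∈-letters⁺ n v k<n)

∈-SignedPerms⁻ : ∀ {n w} → w ∈ SignedPerms n → length w ≡ n × Unique (map ∣_∣ w) × map ∣_∣ w ↭ range 1 n
∈-SignedPerms⁻ {n} {w} w∈ with w∈′ , u ← ∈-filter⁻ unique-abs? {xs = words n n} w∈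
  with l , w⊆ ← ∈-tuples⁻ n (≡.subst (w ∈_) (words≡tuples n n) w∈′) =
  l , u , ⊆∧length⇒↭ u (λ x∈ → sub (∈-map⁻ ∣_∣ x∈))
    (ℕₚ.≤-reflexive (≡.trans (length-range 1 n) (≡.trans (≡.sym l) (≡.sym (Listₚ.length-map ∣_∣ w)))))
  where
  sub : ∀ {i} → ∃[ x ] x ∈ w × i ≡ ∣ x ∣ → i ∈ range 1 n
  sub (x , x∈w , ≡.refl) = ∈-letters⁻ n (All.lookup w⊆ x∈w)

zip-unzip : ∀ {a b} {A : Set a} {B : Set b} (P : List (A × B)) → zip (map proj₁ P) (map proj₂ P) ≡ P
zip-unzip [] = ≡.refl
zip-unzip (p ∷ P) = ≡.cong (p ∷_) (zip-unzip P)

map-proj₁-zip : ∀ {a b} {A : Set a} {B : Set b} (xs : List A) (ys : List B) → length xs ≡ length ys →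
                map proj₁ (zip xs ys) ≡ xs
map-proj₁-zip [] [] _ = ≡.refl
map-proj₁-zip (x ∷ xs) (y ∷ ys) e = ≡.cong (x ∷_) (map-proj₁-zip xs ys (ℕₚ.suc-injective e))

map-proj₂-zip : ∀ {a b} {A : Set a} {B : Set b} (xs : List A) (ys : List B) → length xs ≡ length ys →
                map proj₂ (zip xs ys) ≡ ys
map-proj₂-zip [] [] _ = ≡.refl
map-proj₂-zip (x ∷ xs) (y ∷ ys) e = ≡.cong (y ∷_) (map-proj₂-zip xs ys (ℕₚ.suc-injective e))

-- The rank of p, counted from 0, when P holds all labelled letters. Being invariant under
-- permutation, it can be computed in the order of the word and in sorted order alike.
preceding : List Labelled → Labelled → ℕ
preceding [] p = 0
preceding (r ∷ P) p = χ (does (r ≺? p)) ℕ.+ preceding P p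

χ-yes : ∀ {a} {A : Set a} (A? : Dec A) → A → χ (does A?) ≡ 1
χ-yes A? a = ≡.cong χ (dec-true A? a)

χ-no : ∀ {a} {A : Set a} (A? : Dec A) → ¬ A → χ (does A?) ≡ 0
χ-no A? ¬a = ≡.cong χ (dec-false A? ¬a)

preceding-↭ : ∀ {P Q} p → P ↭ Q → preceding P p ≡ preceding Q p
preceding-↭ p ↭.refl = ≡.refl
preceding-↭ p (↭.prep r e) = ≡.cong (χ (does (r ≺? p)) ℕ.+_) (preceding-↭ p e)
preceding-↭ p (↭.swap r t e) = ≡.trans
  (≡.cong (λ k → χ (does (r ≺? p)) ℕ.+ (χ (does (t ≺? p)) ℕ.+ k)) (preceding-↭ p e))
  (x∙yz≈y∙xz (χ (does (r ≺? p))) (χ (does (t ≺? p))) _)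
preceding-↭ p (↭.trans e f) = ≡.trans (preceding-↭ p e) (preceding-↭ p f)

preceding-none : ∀ {P p} → All (λ r → ¬ (r ≺ p)) P → preceding P p ≡ 0
preceding-none [] = ≡.refl
preceding-none {r ∷ P} {p} (n ∷ ns) rewrite χ-no (r ≺? p) n = preceding-none ns

signed-< : ∀ {i j a} → i < j → χ (does (signed j a ℤ.<? signed i a)) ≡ χ (isOdd a)
signed-< {i} {j} {a} i<j with isOdd a
... | true = χ-yes (ℤ.- (+ j) ℤ.<? ℤ.- (+ i)) (ℤₚ.neg-mono-< (ℤ.+<+ i<j))
... | false = χ-no (+ j ℤ.<? + i) (λ { (ℤ.+<+ j<i) → ℕₚ.<-asym i<j j<i })

signed-> : ∀ {i j a} → i < j → χ (does (signed i a ℤ.<? signed j a)) ℕ.+ χ (isOdd a) ≡ 1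
signed-> {i} {j} {a} i<j with isOdd a
... | true = ≡.cong (ℕ._+ 1) (χ-no (ℤ.- (+ i) ℤ.<? ℤ.- (+ j)) (ℤₚ.<-asym (ℤₚ.neg-mono-< (ℤ.+<+ i<j))))
... | false = ≡.cong (ℕ._+ 0) (χ-yes (+ i ℤ.<? + j) (ℤ.+<+ i<j))

≺?-same : ∀ x y a → χ (does ((x , a) ≺? (y , a))) ≡ χ (does (x ℤ.<? y))
≺?-same x y a = ≡.cong χ (does-⇔
  (mk⇔ (λ { (inj₁ l) → ⊥-elim (ℕₚ.<-irrefl ≡.refl l) ; (inj₂ (_ , l)) → l }) (λ l → inj₂ (≡.refl , l)))
  ((x , a) ≺? (y , a)) (x ℤ.<? y))

later-letter : ∀ {i j} a b → i < j →
  χ (does ((signed j b , b) ≺? (signed i a , a))) ≡ χ (upFrom a ≤ᵇ b)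
later-letter {i} {j} a b i<j with compare a b
... | more a<b u _ = ≡.trans (χ-yes ((signed j b , b) ≺? (signed i a , a)) (inj₁ a<b)) (≡.sym u)
... | less b<a u _ = ≡.trans (χ-no ((signed j b , b) ≺? (signed i a , a))
  (λ { (inj₁ l) → ℕₚ.<-asym b<a l ; (inj₂ (e , _)) → ℕₚ.<-irrefl e b<a })) (≡.sym u)
... | same ≡.refl u _ = ≡.trans (≺?-same (signed j b) (signed i b) b) (≡.trans (signed-< {a = b} i<j) (≡.sym u))

-- Stated as a complement because `dn` counts the earlier letters that do not rank before a.
earlier-letter : ∀ {i j} a b → i < j →
  χ (does ((signed i b , b) ≺? (signed j a , a))) ℕ.+ χ (b <ᵇ downBelow a) ≡ 1
earlier-letter {i} {j} a b i<j with compare a b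
... | more a<b _ d = ≡.cong₂ ℕ._+_ (χ-yes ((signed i b , b) ≺? (signed j a , a)) (inj₁ a<b)) d
... | less b<a _ d = ≡.cong₂ ℕ._+_ (χ-no ((signed i b , b) ≺? (signed j a , a))
  (λ { (inj₁ l) → ℕₚ.<-asym b<a l ; (inj₂ (e , _)) → ℕₚ.<-irrefl e b<a })) d
... | same ≡.refl _ d = ≡.trans (≡.cong₂ ℕ._+_ (≺?-same (signed i b) (signed j b) b) d) (signed-> {a = b} i<j)

label-prefix : List ℕ → List Labelled
label-prefix [] = []
label-prefix (a ∷ γ) = (signed (suc (length γ)) a , a) ∷ label-prefix γ

preceding-label : ∀ {i} j a β → i < j → preceding (label j β) (signed i a , a) ≡ up a β
preceding-label j a [] l = ≡.refl
preceding-label j a (b ∷ β) l = ≡.cong₂ ℕ._+_ (later-letter a b l)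
    (preceding-label (suc j) a β (ℕₚ.m<n⇒m<1+n l))

preceding-prefix : ∀ {j} a γ → length γ < j → preceding (label-prefix γ) (signed j a , a) ℕ.+ dn a γ ≡ length γ
preceding-prefix a [] l = ≡.refl
preceding-prefix {j} a (b ∷ γ) l = ≡.trans
  (interchange (χ (does ((signed (suc (length γ)) b , b) ≺? (signed j a , a)))) _ (χ (b <ᵇ downBelow a)) _)
  (≡.cong₂ ℕ._+_ (earlier-letter a b l) (preceding-prefix a γ (ℕₚ.<⇒≤ l)))

Compatible : List ℤ × List ℕ → Set
Compatible (w , b) = Linked _≺_ (zip w b) × All SignMatches (zip w b)

matches? : ∀ p → Dec (SignMatches p)
matches? (x , v) = isNeg x Boolₚ.≟ isOdd v

compatible? : ∀ wb → Dec (Compatible wb)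
compatible? (w , b) = linked? _≺?_ (zip w b) ×-dec All.all? matches? (zip w b)

module Standardization {c ℓ} (R : CommutativeRing c ℓ) (q Y₀ Y₁ Z : CommutativeRing.Carrier R) where
  open CommutativeRing R
  open Series R using (pow)
  open ListSums R
  open RightSide R q Y₀ Y₁ Z using (x; Y; wordSum; letters≤)
  open FixedPointWeights R x using (mark; weight)
  open import Algebra.Solver.Ring.NaturalCoefficients.Default commutativeSemiring
    using (solve; _:*_; _:=_)

  product : ∀ {a} {A : Set a} → List A → (A → Carrier) → Carrier
  product [] f = 1#
  product (y ∷ ys) f = f y * product ys f

  product-cong : ∀ {a} {A : Set a} (ys : List A) {f g} → (∀ {y} → y ∈ ys → f y ≈ g y) → product ys f ≈
      product ys g
  product-cong [] p = refl
  product-cong (y ∷ ys) p = *-cong (p (here ≡.refl)) (product-cong ys (p ∘ there))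

  product-↭ : ∀ {a} {A : Set a} {ys zs : List A} f → ys ↭ zs → product ys f ≈ product zs f
  product-↭ f ↭.refl = refl
  product-↭ f (↭.prep y p) = *-congˡ (product-↭ f p)
  product-↭ f (↭.swap y z p) = trans (*-congˡ (*-congˡ (product-↭ f p)))
    (solve 3 (λ a b c → a :* (b :* c) := b :* (a :* c)) refl _ _ _)
  product-↭ f (↭.trans p r) = trans (product-↭ f p) (product-↭ f r)

  pow-+ : ∀ y m n → pow y (m ℕ.+ n) ≈ pow y m * pow y n
  pow-+ y zero n = sym (*-identityˡ _)
  pow-+ y (suc m) n = trans (*-congˡ (pow-+ y m n)) (sym (*-assoc _ _ _))

  fixAt : ℕ → ℤ → Carrier
  fixAt k y = pow Y₀ (χ (does (y ℤ.≟ + k))) * pow Y₁ (χ (does (y ℤ.≟ ℤ.- (+ k))))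

  fixAt-signed : ∀ j k a → fixAt (suc k) (signed (suc j) a) ≈ mark (j ≡ᵇ k) (Y a)
  fixAt-signed j k a with isOdd a
  ... | false = positive (j ≡ᵇ k)
    where
    positive : ∀ b → pow Y₀ (χ b) * 1# ≈ mark b Y₀
    positive true = trans (*-identityʳ _) (*-identityʳ _)
    positive false = *-identityʳ _
  ... | true = negative (j ≡ᵇ k)
    where
    negative : ∀ b → 1# * pow Y₁ (χ b) ≈ mark b Y₁
    negative true = trans (*-identityˡ _) (*-identityʳ _)
    negative false = *-identityʳ _

  local : (Labelled → ℕ) → Labelled → Carrier
  local rank (y , v) = x v * fixAt (suc (rank (y , v))) y

  -- A letter a between γ and β has rank `(length γ ∸ dn a γ) + up a β`, which is its place
  -- `length γ` iff `up a β ≡ dn a γ`. Marks thus depend on ranks alone, and the product may be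
  -- reordered.
  weight-local : ∀ γ β → weight Y γ β ≈
    product (label (suc (length γ)) β)
      (local (λ p → preceding (label-prefix γ) p ℕ.+ preceding (label (suc (length γ)) β) p))
  weight-local γ [] = refl
  weight-local γ (a ∷ β) = *-cong (*-congˡ (sym (trans (fixAt-signed j _ a)
      (reflexive (≡.cong (λ b → mark b (Y a)) flag)))))
    (trans (weight-local (a ∷ γ) β) (product-cong (label (suc (suc j)) β) (λ {p} _ →
      reflexive (≡.cong (λ k → local (λ _ → k) p) (shift-rank (χ (does (s ≺? p)))
          (preceding (label-prefix γ) p) _)))))
    where
    j = length γ
    s = signed (suc j) a , a
    shift-rank : ∀ a b c → (a ℕ.+ b) ℕ.+ c ≡ b ℕ.+ (a ℕ.+ c)
    shift-rank a b c = ≡.trans (≡.cong (ℕ._+ c) (ℕₚ.+-comm a b)) (ℕₚ.+-assoc b a c)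
    u = preceding (label-prefix γ) s
    rank≡ : u ℕ.+ preceding (s ∷ label (suc (suc j)) β) s ≡ u ℕ.+ up a β
    rank≡ = ≡.cong (u ℕ.+_) (≡.cong₂ ℕ._+_ (χ-no (s ≺? s) (≺-irrefl s))
        (preceding-label (suc (suc j)) a β (ℕₚ.n<1+n (suc j))))
    u+dn : u ℕ.+ dn a γ ≡ j
    u+dn = preceding-prefix a γ (ℕₚ.n<1+n j)
    flag : (j ≡ᵇ u ℕ.+ preceding (s ∷ label (suc (suc j)) β) s) ≡ (up a β ≡ᵇ dn a γ)
    flag with up a β ℕ.≟ dn a γ
    ... | yes e = ≡.trans (≡ᵇ-true (≡.trans (≡.sym u+dn)
        (≡.trans (≡.cong (u ℕ.+_) (≡.sym e)) (≡.sym rank≡)))) (≡.sym (≡ᵇ-true e))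
    ... | no n = ≡.trans (≡ᵇ-false (λ e → n (≡.sym (ℕₚ.+-cancelˡ-≡ u _ _
        (≡.trans u+dn (≡.trans e rank≡)))))) (≡.sym (≡ᵇ-false n))

  fixStat : ℕ → List ℤ → Carrier
  fixStat i w = pow Y₀ (fixFrom (λ z → z) i w) * pow Y₁ (fixFrom ℤ.-_ i w)

  -- In a sorted list the rank is the index, so the mark asks whether the k-th letter of w is k or
  -- -k. The offset i counts the entries already split off.
  sorted-local : ∀ i P → AllPairs _≺_ P →
    product P (local (λ p → i ℕ.+ preceding P p)) ≈ fixStat (suc i) (map proj₁ P) * product (map proj₂ P) x
  sorted-local i [] s = sym (trans (*-identityʳ _) (*-identityʳ _))
  sorted-local i (p@(y , v) ∷ P) (p≺ ∷ s) = trans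
    (*-cong (reflexive (≡.cong (λ k → local (λ _ → k) p) first))
      (trans (product-cong P (λ {r} r∈P → reflexive (≡.cong (λ k → local (λ _ → k) r) (rest r∈P))))
          (sorted-local (suc i) P s)))
    (trans
      (solve 6 (λ x a b c d z → (x :* (a :* b)) :* (c :* d :* z) := (a :* c) :* (b :* d) :* (x :* z)) refl
        (x v) _ _ (pow Y₀ (fixFrom (λ z → z) (suc (suc i)) (map proj₁ P)))
            (pow Y₁ (fixFrom ℤ.-_ (suc (suc i)) (map proj₁ P))) _)
      (*-congʳ (sym (*-cong (pow-+ Y₀ (χ (does (y ℤ.≟ + suc i))) _)
          (pow-+ Y₁ (χ (does (y ℤ.≟ ℤ.- (+ suc i)))) _)))))
    where
    first : i ℕ.+ preceding (p ∷ P) p ≡ i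
    first = ≡.trans (≡.cong (i ℕ.+_) (preceding-none (≺-irrefl p ∷ All.map
        (λ {r} p≺r r≺p → ≺-asym {p} {r} p≺r r≺p) p≺))) (ℕₚ.+-identityʳ i)
    rest : ∀ {r} → r ∈ P → i ℕ.+ preceding (p ∷ P) r ≡ suc i ℕ.+ preceding P r
    rest {r} r∈P = ≡.trans (≡.cong (λ k → i ℕ.+ (k ℕ.+ preceding P r))
        (χ-yes (p ≺? r) (All.lookup p≺ r∈P))) (ℕₚ.+-suc i _)

  -- Equal lengths ensure that `zip w b` determines w and b.
  Standardizes : List ℕ → List ℤ × List ℕ → Set
  Standardizes c (w , b) = label 1 c ↭ zip w b × AllPairs _≺_ (zip w b) × length w ≡ length b

  weight-standardized : ∀ {c wb} → Standardizes c wb → weight Y [] c ≈ fixStat 1 (proj₁ wb) * product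
      (proj₂ wb) x
  weight-standardized {c} {w , b} (p , s , l) = trans (weight-local [] c) (trans (product-↭ _ p)
    (trans (product-cong (zip w b) (λ {r} _ → reflexive (≡.cong (λ k → local (λ _ → k) r) (preceding-↭ r p))))
      (trans (sorted-local 0 (zip w b) s)
        (reflexive (≡.cong₂ (λ w b → fixStat 1 w * product b x) (map-proj₁-zip w b l) (map-proj₂-zip w b l))))))

  compatibleSum : ℕ → ℕ → List ℤ → Carrier
  compatibleSum s n w = Σₗ (tuples (letters≤ s) n) (λ b → if does (compatible? (w , b)) then product b x
      else 0#)

  words-permutations : ∀ s n → wordSum Y s n ≈ Σₗ (SignedPerms n) (λ w → fixStat 1 w * compatibleSum s n w)
  words-permutations s n = trans
    (Σₗ-correspondence Standardizes (tuples L n) (filter compatible? pairs) {weight Y []}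
      {λ wb → fixStat 1 (proj₁ wb) * product (proj₂ wb) x} (tuples-unique uL n)
      (Unique.filter⁺ compatible? (Unique.cartesianProduct⁺ (SignedPerms-unique n) (tuples-unique uL n)))
      standardize unstandardize
      (λ (p , _) (p′ , _) → label-injective 1 (↭-trans p (↭-sym p′)))
      functional
      (λ _ → weight-standardized))
    (trans (Σₗ-filter compatible? pairs _) (trans (Σₗ-cartesianProductWith _,_ (SignedPerms n) (tuples L n) _)
      (Σₗ-cong (SignedPerms n) (λ {w} _ → trans (Σₗ-cong (tuples L n)
          (λ {b} _ → pull (does (compatible? (w , b)))))
        (Σₗ-* (tuples L n) (fixStat 1 w) _)))))
    where
    L = letters≤ s
    uL = Unique.downFrom⁺ (suc s)
    pairs = cartesianProduct (SignedPerms n) (tuples L n)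
    pull : ∀ t {a b} → (if t then a * b else 0#) ≈ a * (if t then b else 0#)
    pull true = refl
    pull false = sym (zeroʳ _)
    functional : ∀ {c wb wb′} → Standardizes c wb → Standardizes c wb′ → wb ≡ wb′
    functional {wb = w , b} {w′ , b′} (p , s , l) (p′ , s′ , l′) = ≡.cong₂ _,_
      (≡.trans (≡.sym (map-proj₁-zip w b l)) (≡.trans (≡.cong (map proj₁) e) (map-proj₁-zip w′ b′ l′)))
      (≡.trans (≡.sym (map-proj₂-zip w b l)) (≡.trans (≡.cong (map proj₂) e) (map-proj₂-zip w′ b′ l′)))
      where
      e : zip w b ≡ zip w′ b′
      e = sorted-unique s s′ (↭-trans (↭-sym p) p′)
    standardize : ∀ {c} → c ∈ tuples L n → ∃[ wb ] wb ∈ filter compatible? pairs × Standardizes c wb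
    standardize {c} c∈ with lc , c⊆ ← ∈-tuples⁻ n c∈
      with P , sorted , p ← sorting (label 1 c) (AllPairs.map (λ {p} {r} → ≺-comparable {p} {r})
        (AllPairsₚ.map⁻ {f = proj₁} (Unique.map⁻ {f = ∣_∣} (≡.subst Unique
          (≡.trans (≡.sym (absolute-label 1 c)) (Listₚ.map-∘ (label 1 c))) (range-unique 1 (length c)))))) =
      (map proj₁ P , map proj₂ P)
      , ∈-filter⁺ compatible? (∈-cartesianProduct⁺
          (∈-SignedPerms⁺ P (≡.subst (λ k → map absolute P ↭ range 1 k) lc
            (≡.subst (map absolute P ↭_) (absolute-label 1 c) (map⁺ absolute p))) signs)
          b∈)
          (≡.subst (λ Q → Linked _≺_ Q × All SignMatches Q) (≡.sym (zip-unzip P))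
              (AllPairs⇒Linked sorted , signs))
      , ≡.subst (label 1 c ↭_) (≡.sym (zip-unzip P)) (↭-sym p)
      , ≡.subst (AllPairs _≺_) (≡.sym (zip-unzip P)) sorted
      , ≡.trans (Listₚ.length-map proj₁ P) (≡.sym (Listₚ.length-map proj₂ P))
      where
      signs : All SignMatches P
      signs = All-resp-↭ (↭-sym p) (matches-label 0 c)
      b↭c : map proj₂ P ↭ c
      b↭c = ≡.subst (map proj₂ P ↭_) (letters-label 1 c) (map⁺ proj₂ p)
      b∈ : map proj₂ P ∈ tuples L n
      b∈ = ≡.subst (λ k → map proj₂ P ∈ tuples L k) (≡.trans (↭-length b↭c) lc)
          (∈-tuples⁺ (All-resp-↭ (↭-sym b↭c) c⊆))
    unstandardize : ∀ {wb} → wb ∈ filter compatible? pairs → ∃[ c ] c ∈ tuples L n × Standardizes c wb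
    unstandardize {w , b} wb∈ with wb∈′ , linked , signs ← ∈-filter⁻ compatible? {xs = pairs} wb∈
      with w∈ , b∈ ← ∈-cartesianProduct⁻ (SignedPerms n) (tuples L n) wb∈′
      with lw , _ , pw ← ∈-SignedPerms⁻ {n} w∈ | lb , b⊆ ← ∈-tuples⁻ n b∈
      with c , p ← labelling 1 n (zip w b) (≡.subst (_↭ range 1 n)
        (≡.trans (≡.cong (map ∣_∣) (≡.sym (map-proj₁-zip w b (≡.trans lw (≡.sym lb)))))
            (≡.sym (Listₚ.map-∘ (zip w b)))) pw) signs =
      c , ≡.subst (λ k → c ∈ tuples L k) (≡.trans (↭-length c↭b) lb) (∈-tuples⁺ (All-resp-↭ (↭-sym c↭b) b⊆))
      , p , Linked⇒AllPairs (λ {p} {r} {t} → ≺-trans {p} {r} {t}) linked , ≡.trans lw (≡.sym lb)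
      where
      c↭b : c ↭ b
      c↭b = ≡.subst₂ _↭_ (letters-label 1 c) (map-proj₂-zip w b (≡.trans lw (≡.sym lb))) (map⁺ proj₂ p)

-- Recursions for descents, and the sum over compatible words for a fixed signed permutation

length-desPositions : ∀ i j w → length (desPositions i w) ≡ length (desPositions j w)
length-desPositions i j [] = ≡.refl
length-desPositions i j (x ∷ []) = ≡.refl
length-desPositions i j (x ∷ y ∷ w) with does (y ℤ.<? x) | length-desPositions (suc i) (suc j) (y ∷ w)
... | true | e = ≡.cong suc e
... | false | e = e

sum-desPositions : ∀ i w → sum (desPositions (suc i) w) ≡ sum (desPositions i w) ℕ.+ length (desPositions i w)
sum-desPositions i [] = ≡.refl
sum-desPositions i (x ∷ []) = ≡.refl
sum-desPositions i (x ∷ y ∷ w) with does (y ℤ.<? x) | sum-desPositions (suc i) (y ∷ w)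
... | true | e rewrite e =
  solve 3 (λ i s l → con 1 :+ i :+ (s :+ l) := i :+ s :+ (con 1 :+ l)) ≡.refl
    i (sum (desPositions (suc i) (y ∷ w))) (length (desPositions (suc i) (y ∷ w)))
  where open +-*-Solver
... | false | e = e

des-∷ : ∀ x y w → des (x ∷ y ∷ w) ≡ χ (does (y ℤ.<? x)) ℕ.+ des (y ∷ w)
des-∷ x y w with does (y ℤ.<? x)
... | true = ≡.cong suc (length-desPositions 2 1 (y ∷ w))
... | false = length-desPositions 2 1 (y ∷ w)

-- A new first letter moves every descent of w one place to the right, and a descent at the new
-- first place adds 1.
maj-∷ : ∀ x w → maj (x ∷ w) ≡ maj w ℕ.+ des (x ∷ w)
maj-∷ x [] = ≡.refl
maj-∷ x (y ∷ w) rewrite des-∷ x y w with does (y ℤ.<? x)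
... | true rewrite sum-desPositions 1 (y ∷ w) = ≡.sym (ℕₚ.+-suc (maj (y ∷ w)) (des (y ∷ w)))
... | false = sum-desPositions 1 (y ∷ w)

fmaj-∷ : ∀ x w → fmaj (x ∷ w) ≡ fdes (x ∷ w) ℕ.+ fmaj w
fmaj-∷ x w rewrite maj-∷ x w =
  solve 4 (λ m d c n → con 2 :* (m :+ d) :+ (c :+ n) := con 2 :* d :+ c :+ (con 2 :* m :+ n)) ≡.refl
    (maj w) (des (x ∷ w)) (χ (isNeg x)) (neg w)
  where open +-*-Solver

isOdd-fdes : ∀ x w → isOdd (fdes (x ∷ w)) ≡ isNeg x
isOdd-fdes x w = go (des (x ∷ w)) (isNeg x)
  where
  go : ∀ d b → isOdd (2 ℕ.* d ℕ.+ χ b) ≡ b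
  go zero true = ≡.refl
  go zero false = ≡.refl
  go (suc d) b rewrite ℕₚ.+-suc d (d ℕ.+ 0) = ≡.trans (Boolₚ.not-involutive _) (go d b)

-- The least value admissible in front of w, if the letter x is put there and the
-- sign of x is ignored.
bound : ℤ → List ℤ → ℕ
bound x [] = 0
bound x (y ∷ w) = χ (does (y ℤ.<? x)) ℕ.+ fdes (y ∷ w)

-- The value in front must reach the bound and have the parity given by the sign of x, so `fdes` is
-- the bound or one more.
fdes-bound : ∀ x w → ∃[ ε ] fdes (x ∷ w) ≡ bound x w ℕ.+ χ ε
fdes-bound x [] = isNeg x , ≡.refl
fdes-bound x (y ∷ w) = ε , ≡.trans
  (≡.cong (λ d → 2 ℕ.* d ℕ.+ χ (isNeg x)) (des-∷ x y w))
  (≡.trans (solve 3 (λ c d n → con 2 :* (c :+ d) :+ n := con 2 :* d :+ c :+ (c :+ n)) ≡.refl c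
      (des (y ∷ w)) (χ (isNeg x)))
    (≡.trans (≡.cong (2 ℕ.* des (y ∷ w) ℕ.+ c ℕ.+_) (proj₂ excess))
      (solve 4 (λ c d n m → con 2 :* d :+ c :+ (m :+ n) := c :+ (con 2 :* d :+ m) :+ n) ≡.refl c
          (des (y ∷ w)) (χ ε) (χ (isNeg y)))))
  where
  open +-*-Solver
  c = χ (does (y ℤ.<? x))
  excess : ∃[ ε ] c ℕ.+ χ (isNeg x) ≡ χ (isNeg y) ℕ.+ χ ε
  excess with y ℤ.<? x | x ℤ.<? + 0 | y ℤ.<? + 0
  ... | yes _   | yes _   | yes _   = true , ≡.refl
  ... | yes y<x | yes x<0 | no y≮0  = ⊥-elim (y≮0 (ℤₚ.<-trans y<x x<0))
  ... | yes _   | no _    | yes _   = false , ≡.refl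
  ... | yes _   | no _    | no _    = true , ≡.refl
  ... | no _    | yes _   | yes _   = false , ≡.refl
  ... | no _    | yes _   | no _    = true , ≡.refl
  ... | no y≮x  | no x≮0  | yes y<0 = ⊥-elim (y≮x (ℤₚ.<-≤-trans y<0 (ℤₚ.≮⇒≥ x≮0)))
  ... | no _    | no _    | no _    = false , ≡.refl
  ε = proj₁ excess

-- `true` on the empty word agrees with `linked?`, which accepts lists too short for a comparison.
onHead : (ℕ → Bool) → List ℕ → Bool
onHead f [] = true
onHead f (v ∷ b) = f v

module MacMahon {c ℓ} (R : CommutativeRing c ℓ) (q Y₀ Y₁ Z : CommutativeRing.Carrier R) where
  open CommutativeRing R
  open Series R using (pow; Σ≤; Zodd)
  open FiniteSums R using (Σ≤-cong; Σ≤-extend; Σ≤-zero)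
  open ListSums R
  open RightSide R q Y₀ Y₁ Z using (x; letters≤; q²; pow-double)
  open Standardization R q Y₀ Y₁ Z using (product; compatibleSum; pow-+)
  open import Algebra.Solver.Ring.NaturalCoefficients.Default commutativeSemiring
    using (solve; _:*_; _:=_)
  open import Relation.Binary.Reasoning.Setoid setoid

  -- The generating polynomial, by q²-weight, of the partitions with at most n parts, all ≤ k.
  partitions : ℕ → ℕ → Carrier
  partitions zero k = 1#
  partitions (suc n) zero = 1#
  partitions (suc n) (suc k) = partitions (suc n) k + pow q² (suc k) * partitions n (suc k)

  partitions-zero : ∀ n → partitions n 0 ≈ 1#
  partitions-zero zero = refl
  partitions-zero (suc n) = refl

  -- evens n m is the coefficient of t^m in (1+t)/(t²;q²)_{n+1}, and shifted n m d that of t^{m-d}.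
  evens : ℕ → ℕ → Carrier
  evens n m = partitions n ⌊ m /2⌋

  shifted : ℕ → ℕ → ℕ → Carrier
  shifted n m zero = evens n m
  shifted n zero (suc d) = 0#
  shifted n (suc m) (suc d) = shifted n m d

  sameParity : ℕ → ℕ → Bool
  sameParity m n = does (isOdd m Boolₚ.≟ isOdd n)

  sameParity-suc : ∀ m n → sameParity (suc m) (suc n) ≡ sameParity m n
  sameParity-suc m n with isOdd m | isOdd n
  ... | true | true = ≡.refl
  ... | true | false = ≡.refl
  ... | false | true = ≡.refl
  ... | false | false = ≡.refl

  evens-odd : ∀ n k → evens n (suc (k ℕ.+ k)) ≡ partitions n k
  evens-odd n k = ≡.cong (partitions n) (≡.sym (ℕₚ.n≡⌈n+n/2⌉ k))

  evens-even : ∀ n k → evens n (k ℕ.+ k) ≡ partitions n k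
  evens-even n k = ≡.cong (partitions n) (≡.sym (ℕₚ.n≡⌊n+n/2⌋ k))

  private
    choose : Bool → Carrier → Carrier
    choose b y = if b then y else 0#

  choose-cong : ∀ b {y z} → y ≈ z → choose b y ≈ choose b z
  choose-cong true e = e
  choose-cong false _ = refl

  choose-* : ∀ b y z → y * choose b z ≈ choose b (y * z)
  choose-* true y z = refl
  choose-* false y z = zeroʳ y

  choose-0 : ∀ b → choose b 0# ≈ 0#
  choose-0 true = refl
  choose-0 false = refl

  -- For even v this is the splitting of partitions by their largest part. For odd v the
  -- coefficients at v and v - 1 coincide.
  evens-step : ∀ n v → evens (suc n) v ≈ shifted (suc n) v 1 + choose (sameParity 0 v) (pow q v * evens n v)
  evens-step n zero = sym (trans (+-identityˡ _) (trans (*-identityˡ _) (partitions-zero n)))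
  evens-step n (suc v) with parity v
  ... | k , inj₁ ≡.refl rewrite isOdd-double k | ≡.sym (ℕₚ.n≡⌈n+n/2⌉ k) | ≡.sym (ℕₚ.n≡⌊n+n/2⌋ k) = sym
      (+-identityʳ _)
  ... | k , inj₂ ≡.refl rewrite isOdd-double k | ≡.sym (ℕₚ.n≡⌈n+n/2⌉ k) | ≡.sym (ℕₚ.n≡⌊n+n/2⌋ k) =
    +-congˡ (*-congʳ (trans (*-congˡ (pow-double k)) (*-assoc _ _ _)))

  -- The telescoping step for the sum over first letters v, with e the bound and e + χ ε the value
  -- of `fdes`. The correction ε does no harm: if it is 1, only v of the parity of e + 1 count, and
  -- there t^{v-e} and t^{v-e-1} have the same coefficient in (1+t)/(t²;q²)_{n+1}.
  shifted-step : ∀ n v e ε → pow q (e ℕ.+ χ ε) * shifted (suc n) v (e ℕ.+ χ ε) ≈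
    pow q (e ℕ.+ χ ε) * shifted (suc n) v (suc (e ℕ.+ χ ε)) +
    choose (sameParity (e ℕ.+ χ ε) v) (pow q v * shifted n v e)
  shifted-step n zero (suc e) ε = trans (zeroʳ _) (sym (trans
    (+-cong (zeroʳ _) (trans (choose-cong (sameParity (suc (e ℕ.+ χ ε)) 0) (zeroʳ _))
        (choose-0 (sameParity (suc (e ℕ.+ χ ε)) 0)))) (+-identityˡ _)))
  shifted-step n (suc v) (suc e) ε rewrite sameParity-suc (e ℕ.+ χ ε) v = trans (*-assoc _ _ _)
    (trans (*-congˡ (shifted-step n v e ε))
      (trans (distribˡ _ _ _) (+-cong (sym (*-assoc _ _ _))
        (trans (choose-* (sameParity (e ℕ.+ χ ε) v) _ _)
            (choose-cong (sameParity (e ℕ.+ χ ε) v) (sym (*-assoc _ _ _)))))))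
  shifted-step n v zero false = trans (*-identityˡ _) (trans (evens-step n v) (+-congʳ (sym (*-identityˡ _))))
  shifted-step n zero zero true = trans (zeroʳ _) (sym (trans (+-identityʳ _) (zeroʳ _)))
  shifted-step n (suc v) zero true = trans (*-congʳ (*-identityʳ q)) (trans (*-congˡ (evens-step n v))
    (trans (distribˡ _ _ _) (+-cong (*-congʳ (sym (*-identityʳ q)))
      (trans (choose-* (sameParity 0 v) _ _) (trans (odd-case (parity v))
        (reflexive (≡.cong (λ b → choose b (pow q (suc v) * evens n (suc v)))
            (≡.sym (sameParity-suc 0 v)))))))))
    where
    odd-case : ∃[ k ] (v ≡ k ℕ.+ k ⊎ v ≡ suc (k ℕ.+ k)) →
      choose (sameParity 0 v) (q * (pow q v * evens n v)) ≈ choose (sameParity 0 v)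
          (pow q (suc v) * evens n (suc v))
    odd-case (k , inj₁ ≡.refl) rewrite evens-odd n k | evens-even n k =
      choose-cong (sameParity 0 (k ℕ.+ k)) (sym (*-assoc _ _ _))
    odd-case (k , inj₂ ≡.refl) rewrite isOdd-double k = refl

  wordStat : List ℤ → Carrier
  wordStat w = pow q (fmaj w) * pow Z (neg w)

  module _ (s : ℕ) where

    continuations : ℤ → ℕ → List ℤ → Carrier
    continuations y v w = Σₗ (tuples (letters≤ s) (length w))
      (λ b → choose (does (linked? _≺?_ ((y , v) ∷ zip w b)) ∧ does (All.all? matches? (zip w b)))
          (product b x))

    starting : ℤ → List ℤ → ℕ → Carrier
    starting y w v = choose (does (matches? (y , v))) (x v * continuations y v w)

    starting-sum : ∀ y w (f : ℕ → Bool) → Σₗ (tuples (letters≤ s) (suc (length w)))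
        (λ b → choose ((onHead f b ∧ does (linked? _≺?_ (zip (y ∷ w) b))) ∧ does
            (All.all? matches? (zip (y ∷ w) b))) (product b x))
      ≈ Σ≤ s (λ v → choose (f v) (starting y w v))
    starting-sum y w f = trans (Σₗ-tuples (letters≤ s) (length w) _) (trans
      (Σₗ-cong (letters≤ s) (λ {v} _ → trans
        (Σₗ-cong (tuples (letters≤ s) (length w)) (λ {b} _ → rearrange (f v) _ (does (matches? (y , v)))
            _ (x v) (product b x)))
        (trans (Σₗ-* (tuples (letters≤ s) (length w)) (choose (f v ∧ does (matches? (y , v))) (x v)) _)
          (collect (f v) (does (matches? (y , v))) (x v) _))))
      (Σₗ-downFrom s _))
      where
      rearrange : ∀ f l m r k p → choose ((f ∧ l) ∧ (m ∧ r)) (k * p) ≈ choose (f ∧ m) k * choose (l ∧ r) p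
      rearrange false l m r k p = sym (zeroˡ _)
      rearrange true true true r k p = sym (choose-* r k p)
      rearrange true true false r k p = sym (zeroˡ _)
      rearrange true false true r k p = sym (zeroʳ _)
      rearrange true false false r k p = sym (zeroˡ _)
      collect : ∀ f m k p → choose (f ∧ m) k * p ≈ choose f (choose m (k * p))
      collect false m k p = zeroˡ _
      collect true false k p = zeroˡ _
      collect true true k p = refl

    Σ≤-truncate : ∀ {v} (f : ℕ → Bool) g → v ≤ s → (∀ i → i ≤ v → f i ≡ true) → (∀ i → v < i → f i ≡ false) →
                  Σ≤ s (λ i → choose (f i) (g i)) ≈ Σ≤ v g
    Σ≤-truncate {v} f g v≤s t n = trans
      (sym (Σ≤-extend v≤s (λ i v<i → reflexive (≡.cong (λ b → choose b (g i)) (n i v<i)))))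
      (Σ≤-cong v (λ i i≤v → reflexive (≡.cong (λ b → choose b (g i)) (t i i≤v))))

    continuations-sum : ∀ y v z w → continuations y v (z ∷ w) ≈
      Σ≤ s (λ u → choose (does ((y , v) ≺? (z , u))) (starting z w u))
    continuations-sum y v z w = trans
      (Σₗ-cong (tuples (letters≤ s) (suc (length w))) (λ {b} _ → reflexive
        (≡.cong (λ t → choose (t ∧ does (All.all? matches? (zip (z ∷ w) b))) (product b x)) (unfold b))))
      (starting-sum z w (λ u → does ((y , v) ≺? (z , u))))
      where
      unfold : ∀ b → does (linked? _≺?_ ((y , v) ∷ zip (z ∷ w) b)) ≡
        onHead (λ u → does ((y , v) ≺? (z , u))) b ∧ does (linked? _≺?_ (zip (z ∷ w) b))
      unfold [] = ≡.refl
      unfold (u ∷ b) = ≡.refl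

    -- All partial sums m are needed, since the letters that may follow a value v form an initial
    -- segment ending at v or v - 1. The induction alternates with `continuations-closed`.
    starting-closed : ∀ y w → Unique (y ∷ w) → ∀ m → m ≤ s →
      Σ≤ m (starting y w) ≈ wordStat (y ∷ w) * shifted (suc (length w)) m (fdes (y ∷ w))

    -- The next value u satisfies u ≤ v at an ascent and u < v at a descent. A descent thus costs
    -- one factor t, which `bound` records.
    continuations-closed : ∀ y w → Unique (y ∷ w) → ∀ v → v ≤ s →
      continuations y v w ≈ wordStat w * shifted (length w) v (bound y w)
    continuations-closed y [] _ v v≤s = trans (+-identityʳ _) (sym (trans (*-identityʳ _) (*-identityʳ _)))
    continuations-closed y (z ∷ w) ((y≢z ∷ _) ∷ uw) v v≤s with ℤₚ.<-cmp y z
    ... | tri≈ _ y≡z _ = ⊥-elim (y≢z y≡z)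
    ... | tri< y<z _ z≮y rewrite dec-false (z ℤ.<? y) z≮y = trans (continuations-sum y v z w)
      (trans (Σ≤-truncate (λ u → does ((y , v) ≺? (z , u))) (starting z w) v≤s
          (λ u u≤v → dec-true ((y , v) ≺? (z , u)) (weakly u≤v))
          (λ u v<u → dec-false ((y , v) ≺? (z , u))
            (λ { (inj₁ u<v) → ℕₚ.<-asym v<u u<v ; (inj₂ (v≡u , _)) → ℕₚ.<-irrefl v≡u v<u })))
        (starting-closed z w uw v v≤s))
      where
      weakly : ∀ {u} → u ≤ v → (y , v) ≺ (z , u)
      weakly u≤v with ℕₚ.m≤n⇒m<n∨m≡n u≤v
      ... | inj₁ u<v = inj₁ u<v
      ... | inj₂ u≡v = inj₂ (≡.sym u≡v , y<z)
    continuations-closed y (z ∷ w) (_ ∷ uw) zero v≤s | tri> y≮z _ z<y rewrite dec-true (z ℤ.<? y) z<y =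
      trans (continuations-sum y 0 z w) (trans
        (Σ≤-zero s (λ u _ → reflexive (≡.cong (λ b → choose b (starting z w u)) (dec-false ((y , 0) ≺? (z , u))
          (λ { (inj₁ ()) ; (inj₂ (_ , y<z)) → y≮z y<z })))))
        (sym (zeroʳ _)))
    continuations-closed y (z ∷ w) (_ ∷ uw) (suc v) v<s | tri> y≮z _ z<y rewrite dec-true (z ℤ.<? y) z<y =
      trans (continuations-sum y (suc v) z w)
      (trans (Σ≤-truncate (λ u → does ((y , suc v) ≺? (z , u))) (starting z w) (ℕₚ.<⇒≤ v<s)
          (λ u u≤v → dec-true ((y , suc v) ≺? (z , u)) (inj₁ (s≤s u≤v)))
          (λ u v<u → dec-false ((y , suc v) ≺? (z , u))
            (λ { (inj₁ u≤v) → ℕₚ.<⇒≱ v<u (ℕₚ.≤-pred u≤v) ; (inj₂ (_ , y<z)) → y≮z y<z })))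
        (starting-closed z w uw v (ℕₚ.<⇒≤ v<s)))

    starting-closed y w u = go
      where
      n = length w
      d = fdes (y ∷ w)
      -- `wordStat (y ∷ w)` without the factor q^d, which `shifted-step` supplies.
      K = wordStat w * pow Z (χ (isNeg y))
      increment : ℕ → Carrier
      increment v = choose (sameParity d v) (pow q v * shifted n v (bound y w))
      stat-∷ : wordStat (y ∷ w) ≈ K * pow q d
      stat-∷ = trans (*-cong (trans (reflexive (≡.cong (pow q) (fmaj-∷ y w))) (pow-+ q d (fmaj w)))
                             (pow-+ Z (χ (isNeg y)) (neg w)))
        (solve 4 (λ a b c e → (a :* b) :* (c :* e) := (b :* e) :* c :* a) refl _ _ _ _)
      step : ∀ v → wordStat (y ∷ w) * shifted (suc n) v d ≈
             wordStat (y ∷ w) * shifted (suc n) v (suc d) + K * increment v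
      step v with ε , e ← fdes-bound y w = trans (*-congʳ stat-∷) (trans (*-assoc _ _ _) (trans
        (*-congˡ (≡.subst (λ d → pow q d * shifted (suc n) v d ≈ pow q d * shifted (suc n) v (suc d) +
          choose (sameParity d v) (pow q v * shifted n v (bound y w))) (≡.sym e)
              (shifted-step n v (bound y w) ε)))
        (trans (distribˡ _ _ _) (+-congʳ (trans (sym (*-assoc _ _ _)) (*-congʳ (sym stat-∷)))))))
      summand : ∀ v → v ≤ s → starting y w v ≈ K * increment v
      summand v v≤s rewrite isOdd-fdes y w with isNeg y Boolₚ.≟ isOdd v
      ... | no _ = sym (zeroʳ _)
      ... | yes e = trans (*-cong (*-congˡ (Zodd-neg e)) (continuations-closed y w u v v≤s))
        (solve 4 (λ a b c e → (a :* b) :* (c :* e) := (c :* b) :* (a :* e)) refl _ _ _ _)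
        where
        Zodd-neg : isNeg y ≡ isOdd v → Zodd Z v ≈ pow Z (χ (isNeg y))
        Zodd-neg e rewrite e with isOdd v
        ... | true = sym (*-identityʳ Z)
        ... | false = refl
      go : ∀ m → m ≤ s → Σ≤ m (starting y w) ≈ wordStat (y ∷ w) * shifted (suc n) m d
      go zero m≤s = trans (summand 0 m≤s) (sym (trans (step 0) (trans (+-congʳ (zeroʳ _)) (+-identityˡ _))))
      go (suc m) m<s = trans (+-cong (go m (ℕₚ.<⇒≤ m<s)) (summand (suc m) m<s)) (sym (step (suc m)))

    compatibleSum-closed : ∀ w → Unique w → compatibleSum s (length w) w ≈ wordStat w * shifted
        (length w) s (fdes w)
    compatibleSum-closed [] _ = trans (+-identityʳ _) (sym (trans (*-identityʳ _) (*-identityʳ _)))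
    compatibleSum-closed (y ∷ w) u = trans
      (Σₗ-cong (tuples (letters≤ s) (suc (length w))) (λ {b} _ → reflexive
        (≡.cong (λ t → choose (t ∧ does (All.all? matches? (zip (y ∷ w) b))) (product b x)) (unfold b))))
      (trans (starting-sum y w (λ _ → true)) (starting-closed y w u s ℕₚ.≤-refl))
      where
      unfold : ∀ b → does (linked? _≺?_ (zip (y ∷ w) b)) ≡ onHead (λ _ → true) b ∧ does
          (linked? _≺?_ (zip (y ∷ w) b))
      unfold [] = ≡.refl
      unfold (v ∷ b) = ≡.refl

-- The left-hand side as a convolution with (1+t)/(t²;q²)_{n+1}

module LeftSide {c ℓ} (R : CommutativeRing c ℓ) (q Y₀ Y₁ Z : CommutativeRing.Carrier R) where
  open CommutativeRing R hiding (zero)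
  open Series R
  open SeriesRing R using (seriesRing; inv-correct; ⊗-cong; ⊗≋∗)
  open Cancellation R using (add-cancel)
  open LinearFactors R using (scale-⊗)
  open ListSums R
  open RightSide R q Y₀ Y₁ Z using (q²; RHS-words)
  open Standardization R q Y₀ Y₁ Z using (fixStat; compatibleSum; words-permutations)
  open MacMahon R q Y₀ Y₁ Z
  open PowerSeries R using (_∗_; tail; zero-∗; ∗-comm; ∗-distribʳ; ∗-identityˡ; 1ˢ)
  open RingProperties ring using (-0#≈0#; -‿distribˡ-*; +-cancelˡ)
  open import Algebra.Solver.Ring.NaturalCoefficients.Default commutativeSemiring
    using (solve; _:+_; _:*_; _:=_)
  private
    R₁ = PowerSeries.commutativeRingˢ R
    module P₂ = PowerSeries R₁
    module S = CommutativeRing seriesRing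

  -- Convolution with a is unitriangular, so the coefficients are recovered one after the other
  -- without division.
  ∗-cancelʳ : ∀ {a f g} → a 0 ≈ 1# → (∀ n → (f ∗ a) n ≈ (g ∗ a) n) → ∀ n → f n ≈ g n
  ∗-cancelʳ {a} {f} {g} a₀ e = go
    where
    unit : ∀ k → k * a 0 ≈ k
    unit k = trans (*-congˡ a₀) (*-identityʳ k)
    start : f 0 ≈ g 0
    start = trans (sym (unit (f 0))) (trans (e 0) (unit (g 0)))
    go : ∀ n → f n ≈ g n
    go zero = start
    go (suc n) = ∗-cancelʳ {a} {tail f} {tail g} a₀
      (λ m → +-cancelˡ _ _ _ (trans (e (suc m)) (+-congʳ (*-congʳ (sym start))))) n

  liftT-⊗ : ∀ f g → (liftT f ⊗ liftT g) ≋ liftT (f ∗ g)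
  liftT-⊗ f g zero j = ⊗≋∗ (liftT f) (liftT g) 0 j
  liftT-⊗ f g (suc i) j = trans (⊗≋∗ (liftT f) (liftT g) (suc i) j)
    (trans (+-cong (trans (∗-comm f (λ _ → 0#) j) (zero-∗ f (λ _ → refl) j))
                   (P₂.zero-∗ (liftT g) (λ _ _ → refl) i j))
           (+-identityˡ _))

  liftT-cong : ∀ {f g} → (∀ j → f j ≈ g j) → liftT f ≋ liftT g
  liftT-cong p zero j = p j
  liftT-cong p (suc i) j = refl

  delay : (ℕ → Carrier) → ℕ → Carrier
  delay f zero = 0#
  delay f (suc j) = f j

  tVar-⊗ : ∀ f → (tVar ⊗ liftT f) ≋ liftT (delay f)
  tVar-⊗ f = S.trans (⊗-cong {tVar} {liftT (delay 1ˢ)} {liftT f} {liftT f} tVar≋ S.refl)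
    (S.trans (liftT-⊗ (delay 1ˢ) f) (liftT-cong delay-∗))
    where
    tVar≋ : tVar ≋ liftT (delay 1ˢ)
    tVar≋ zero zero = refl
    tVar≋ zero (suc zero) = refl
    tVar≋ zero (suc (suc j)) = refl
    tVar≋ (suc i) j = refl
    delay-∗ : ∀ j → (delay 1ˢ ∗ f) j ≈ delay f j
    delay-∗ zero = zeroˡ _
    delay-∗ (suc j) = trans (+-cong (zeroˡ _) (∗-identityˡ f j)) (+-identityˡ _)

  t²-factor : ∀ k f g → (∀ j → f j - k * delay (delay f) j ≈ g j) →
              ((one ⊖ scale k (tVar ⊗ tVar)) ⊗ liftT f) ≋ liftT g
  t²-factor k f g e i j = trans (S.distribʳ (liftT f) one (S.- scale k (tVar ⊗ tVar)) i j)
    (trans (+-cong (S.*-identityˡ (liftT f) i j)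
        (trans (S.sym (RP.-‿distribˡ-* (scale k (tVar ⊗ tVar)) (liftT f)) i j)
          (-‿cong (trans (scale-⊗ k (tVar ⊗ tVar) (liftT f) i j) (*-congˡ (t²-delay i j))))))
      (go i j))
    where
    module RP = RingProperties S.ring
    t²-delay : ((tVar ⊗ tVar) ⊗ liftT f) ≋ liftT (delay (delay f))
    t²-delay = S.trans (S.*-assoc tVar tVar (liftT f))
      (S.trans (⊗-cong {tVar} {tVar} {tVar ⊗ liftT f} {liftT (delay f)} S.refl (tVar-⊗ f)) (tVar-⊗ (delay f)))
    go : ∀ i j → liftT f i j - k * liftT (delay (delay f)) i j ≈ liftT g i j
    go zero j = e j
    go (suc i) j = trans (+-identityˡ _) (trans (-‿cong (zeroʳ k)) -0#≈0#)

  P : ℕ → Ser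
  P = poch (tVar ⊗ tVar) q²

  slide : ∀ o p b → o + (q² * 1#) * (p + b * 1#) ≈ (o + (q² * 1#) * p) + (q² * b) * 1#
  slide o p b = trans (+-congˡ (distribˡ _ _ _)) (trans (sym (+-assoc _ _ _))
    (+-congˡ (trans (*-cong (*-identityʳ q²) (*-identityʳ b)) (sym (*-identityʳ _)))))

  -- The second Pascal rule of the Gaussian binomial: if all n + 1 parts are positive, 1 is taken
  -- off each. The definition splits by the largest part instead.
  partitions-rec : ∀ n k → partitions (suc n) (suc k) ≈ partitions n (suc k) + pow q² (suc n) *
      partitions (suc n) k
  partitions-rec 0 0 = refl
  partitions-rec 0 (suc k) = trans (+-congʳ (partitions-rec 0 k))
      (sym (slide 1# (partitions 1 k) (pow q² (suc k))))
  partitions-rec (suc n) 0 =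
    trans (+-congˡ (*-congˡ (partitions-rec n 0))) (slide 1# (partitions n 1) (pow q² (suc n)))
  partitions-rec (suc n) (suc k) =
    trans (+-cong (partitions-rec (suc n) k) (*-congˡ (partitions-rec n (suc k))))
      (solve 6 (λ u v w q a b → (u :+ (q :* a) :* v) :+ (q :* b) :* (w :+ a :* u) :=
                                (u :+ (q :* b) :* w) :+ (q :* a) :* (v :+ b :* u)) refl
        (partitions (suc n) (suc k)) (partitions (suc (suc n)) k) (partitions n (suc (suc k)))
        q² (pow q² (suc n)) (pow q² (suc k)))

  -- Multiplication by 1 - q^{2(n+1)} t² cancels the last factor of the denominator.
  evens-delay : ∀ n j → evens (suc n) j - pow q² (suc n) * delay (delay (evens (suc n))) j ≈ evens n j
  evens-delay n 0 = trans (+-congˡ (trans (-‿cong (zeroʳ _)) -0#≈0#))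
      (trans (+-identityʳ _) (sym (partitions-zero n)))
  evens-delay n 1 = trans (+-congˡ (trans (-‿cong (zeroʳ _)) -0#≈0#))
      (trans (+-identityʳ _) (sym (partitions-zero n)))
  evens-delay n (suc (suc j)) = trans (+-congʳ (partitions-rec n ⌊ j /2⌋)) (add-cancel _ _)

  P-evens : ∀ n → (P (suc n) ⊗ liftT (evens n)) ≋ (one ⊕ tVar)
  P-evens 0 = S.trans (S.*-assoc one f₀ (liftT (evens 0))) (S.trans (S.*-identityˡ (f₀ ⊗ liftT (evens 0)))
    (S.trans (t²-factor 1# (evens 0) 1+t difference) 1+t≋))
    where
    f₀ = one ⊖ scale 1# (tVar ⊗ tVar)
    1+t : ℕ → Carrier
    1+t 0 = 1#
    1+t 1 = 1#
    1+t (suc (suc j)) = 0#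
    difference : ∀ j → evens 0 j - 1# * delay (delay (evens 0)) j ≈ 1+t j
    difference 0 = trans (+-congˡ (trans (-‿cong (zeroʳ _)) -0#≈0#)) (+-identityʳ _)
    difference 1 = trans (+-congˡ (trans (-‿cong (zeroʳ _)) -0#≈0#)) (+-identityʳ _)
    difference (suc (suc j)) = trans (+-congˡ (-‿cong (*-identityˡ _))) (-‿inverseʳ _)
    1+t≋ : liftT 1+t ≋ (one ⊕ tVar)
    1+t≋ 0 0 = sym (+-identityʳ _)
    1+t≋ 0 1 = sym (+-identityˡ _)
    1+t≋ 0 (suc (suc j)) = sym (+-identityˡ _)
    1+t≋ (suc i) j = sym (+-identityˡ _)
  P-evens (suc n) = S.trans (S.*-assoc (P (suc n)) f (liftT (evens (suc n))))
    (S.trans (⊗-cong {P (suc n)} {P (suc n)} {f ⊗ liftT (evens (suc n))} {liftT (evens n)} S.refl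
        (t²-factor (pow q² (suc n)) (evens (suc n)) (evens n) (evens-delay n)))
      (P-evens n))
    where
    f = one ⊖ scale (pow q² (suc n)) (tVar ⊗ tVar)

  P-unit : ∀ n → P n 0 0 ≈ 1#
  P-unit 0 = refl
  P-unit (suc n) = trans (*-cong (P-unit n)
    (trans (+-congˡ (trans (-‿cong (trans (*-congˡ (zeroˡ _)) (zeroʳ _))) -0#≈0#)) (+-identityʳ 1#)))
        (*-identityʳ 1#)

  lhs-term : ∀ n f → ((one ⊕ tVar) ⊗ liftT f ⊗ inv (P (suc n))) ≋ liftT (f ∗ evens n)
  lhs-term n f = S.trans {(one ⊕ tVar) ⊗ liftT f ⊗ inv (P (suc n))}
    (Cancellation.cancel-divisor seriesRing {P (suc n)} {inv (P (suc n))} {liftT (evens n)} {one ⊕ tVar}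
        {liftT f}
      (inv-correct (P (suc n)) (P-unit (suc n))) (P-evens n))
    (liftT-⊗ f (evens n))

  LHS-∗ : ∀ B i j → LHS q B i j ≈ (B i ∗ evens i) j
  LHS-∗ B i j = trans (FiniteSums.Σ≤-last R i (λ n n<i → positive n (ℕₚ.m<n⇒0<n∸m n<i)))
    (trans (reflexive (≡.cong (λ k → lhsTerm i k j) (ℕₚ.n∸n≡0 i))) (lhs-term i (B i) 0 j))
    where
    lhsTerm : ℕ → Ser
    lhsTerm n = (one ⊕ tVar) ⊗ liftT (B n) ⊗ inv (P (suc n))
    positive : ∀ n {k} → 0 < k → lhsTerm n k j ≈ 0#
    positive n {suc k} _ = lhs-term n (B n) (suc k) j

  concentrated-∗ : ∀ n d k m → ((λ j → if does (d ℕ.≟ j) then k else 0#) ∗ evens n) m ≈ k * shifted n m d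
  concentrated-∗ n 0 k 0 = refl
  concentrated-∗ n 0 k (suc m) = trans (+-congˡ (zero-∗ (evens n) (λ _ → refl) m)) (+-identityʳ _)
  concentrated-∗ n (suc d) k 0 = trans (zeroˡ _) (sym (zeroʳ _))
  concentrated-∗ n (suc d) k (suc m) = trans (+-congʳ (zeroˡ _))
      (trans (+-identityˡ _) (concentrated-∗ n d k m))

  Σₗ-∗ : ∀ {a} {A : Set a} (xs : List A) (h : A → ℕ → Carrier) g m → ((λ j → Σₗ xs (λ y → h y j)) ∗ g) m
      ≈ Σₗ xs (λ y → (h y ∗ g) m)
  Σₗ-∗ [] h g m = zero-∗ g (λ _ → refl) m
  Σₗ-∗ (y ∷ xs) h g m = trans (∗-distribʳ g (h y) _ m) (+-congˡ (Σₗ-∗ xs h g m))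

  Bcomb-RHS : ∀ n s → (Bcomb q Y₀ Y₁ Z n ∗ evens n) s ≈ RHS q Y₀ Y₁ Z n s
  Bcomb-RHS n s = sym (trans (RHS-words n s) (trans (words-permutations s n) (sym
    (trans (Σₗ-∗ (SignedPerms n) (λ w j → if does (fdes w ℕ.≟ j) then stat w else 0#) (evens n) s)
      (Σₗ-cong (SignedPerms n) (λ {w} w∈ → trans (concentrated-∗ n (fdes w) (stat w) s)
          (compare-stat w w∈)))))))
    where
    stat : List ℤ → Carrier
    stat w = pow q (fmaj w) * pow Y₀ (fixPlus w) * pow Y₁ (fixMinus w) * pow Z (neg w)
    compare-stat : ∀ w → w ∈ SignedPerms n → stat w * shifted n s (fdes w) ≈ fixStat 1 w * compatibleSum s n w
    compare-stat w w∈ with ≡.refl , u , _ ← ∈-SignedPerms⁻ {n} w∈ = sym (trans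
      (*-congˡ (compatibleSum-closed s w (Unique.map⁻ u)))
      (solve 5 (λ a b c d e → (a :* b) :* ((c :* d) :* e) := (c :* a :* b :* d) :* e) refl _ _ _ _ _))

theorem1p3 : ∀ {c ℓ} (R : CommutativeRing c ℓ) (q Y₀ Y₁ Z : CommutativeRing.Carrier R)
    (B : ℕ → ℕ → CommutativeRing.Carrier R) →
    (Series._≋_ R (Series.LHS R q B) (Series.RHS R q Y₀ Y₁ Z)
    → ∀ n j → CommutativeRing._≈_ R (B n j) (Series.Bcomb R q Y₀ Y₁ Z n j))
    × ((∀ n j → CommutativeRing._≈_ R (B n j) (Series.Bcomb R q Y₀ Y₁ Z n j))
    → Series._≋_ R (Series.LHS R q B) (Series.RHS R q Y₀ Y₁ Z))
theorem1p3 R q Y₀ Y₁ Z B =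
    -- Both families have the same convolution with `evens n`, whose constant term is 1, so they
    -- agree.
    (λ e n → ∗-cancelʳ {evens n} {B n} {Bcomb q Y₀ Y₁ Z n} (partitions-zero n)
      (λ j → trans (sym (LHS-∗ B n j)) (trans (e n j) (sym (Bcomb-RHS n j)))))
  , (λ e n j → trans (LHS-∗ B n j) (trans (∗-cong (e n) (λ _ → refl) j) (Bcomb-RHS n j)))
  where
  open CommutativeRing R
  open Series R using (Bcomb)
  open PowerSeries R using (∗-cong)
  open MacMahon R q Y₀ Y₁ Z using (evens; partitions-zero)
  open LeftSide R q Y₀ Y₁ Z
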